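{- Let $m\in\mathbb{Q}_{>0}$. The map $\psi_{*,m}:\mathbb{Q}[\mu]\langle Y\rangle^0[T]\to\mathbb{Q}[\mu]\langle Y\rangle$, $\sum_{i}w_iT^i\mapsto\sum_i w_i\ast_\mu y_{1,m}^{\ast_\mu i}$ (where $y_{1,m}^{\ast_\mu i}$ is the $i$-fold $\ast_\mu$-power of $y_{1,m}$, and $\mathbb{Q}[\mu]\langle Y\rangle^0[T]$ is the polynomial ring over the commutative algebra $(\mathbb{Q}[\mu]\langle Y\rangle^0,\ast_\mu)$), is an isomorphism of $(\mathbb{Q}[\mu]\langle Y\rangle^0,\ast_\mu)$-algebras onto $(\mathbb{Q}[\mu]\langle Y\rangle,\ast_\mu)$.
   Context: Fix $\mu\in\mathbb{C}$, $\mathrm{Re}(\mu)>0$; $\mathbb{Q}[\mu]\subset\mathbb{C}$ the ring generated by $\mu$. $Y=\{y_{k,m}:k\in\mathbb{N},m\in\mathbb{Q}_{>0}\}$, $\mathbb{Q}[\mu]\langle Y\rangle$ the free $\mathbb{Q}[\mu]$-module on words over $Y$ with concatenation; $y_{\mathbf{k};\mathbf{m}}=y_{k_1,m_1}\cdots y_{k_r,m_r}$. $\odot$ on letters: $y_{k_1,m}\odot y_{k_2,m}=y_{k_1+k_2,m}$; for $m_1\ne m_2$, $y_{k_1,m_1}\odot y_{k_2,m_2}=\sum_{i\le k_1}a_iy_{i,m_1}+\sum_{j\le k_2}b_jy_{j,m_2}$ with $\frac{1}{(x+m_1)^{k_1}(x+m_2)^{k_2}}=\sum\frac{a_i}{(x+m_1)^i}+\sum\frac{b_j}{(x+m_2)^j}$.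 The $\mu$-stuffle product $\ast_\mu$: bilinear, $1\ast_\mu w=w\ast_\mu1=w$, $ux\ast_\mu vy=(u\ast_\mu vy)x+(ux\ast_\mu v)y-\mu(u\ast_\mu v)(x\odot y)$ for letters $x,y$; it is commutative and associative. Admissible words: $1$ and $y_{\mathbf{k};\mathbf{m}}$ with $k_r>1$. Quasi-admissible elements: $y_{k_1,m_1}\cdots y_{k_{r-1},m_{r-1}}(y_{1,m_r}-y_{1,\tilde m_r})$ with $\tilde m_r\ne m_r$. $\mathbb{Q}[\mu]\langle Y\rangle^0$ is the span of admissible words and quasi-admissible elements; it is a $\ast_\mu$-subalgebra. -}

module Defs where

open import Level using (Level; _⊔_)
open import Data.Nat as ℕ using (ℕ; zero; suc)
open import Data.Rational as ℚ using (ℚ; Positive)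
open import Data.Bool using (Bool; true; false; _∧_; if_then_else_)
open import Data.List using (List; []; _∷_; _++_; map; concatMap; reverse; _∷ʳ_; foldr)
open import Data.List.Relation.Unary.All using (All)
open import Data.Product using (_×_; _,_; Σ; proj₁; proj₂)
open import Relation.Nullary.Decidable using (⌊_⌋; yes; no)
open import Relation.Binary.PropositionalEquality using (_≢_)
open import Algebra.Bundles using (CommutativeRing)

-- Letters  y_{k,m}  with k ∈ ℕ_{≥1}, m ∈ ℚ_{>0}.
-- The field  k-1  stores k - 1, i.e. the letter  y k′ m  is  y_{k′+1, m}.

record Letter : Set where
  constructor y
  field
    k-1 : ℕ
    m   : ℚ
    .m>0 : Positive m
open Letter public

idx : Letter → ℕ
idx l = suc (k-1 l)

Word : Set
Word = List Letter

_==ˡ_ : Letter → Letter → Bool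
a ==ˡ b = ⌊ k-1 a ℕ.≟ k-1 b ⌋ ∧ ⌊ m a ℚ.≟ m b ⌋

_==ʷ_ : Word → Word → Bool
[] ==ʷ [] = true
(a ∷ u) ==ʷ (b ∷ v) = (a ==ˡ b) ∧ (u ==ʷ v)
_ ==ʷ _ = false

data Admissible : Word → Set where
  adm-empty : Admissible []
  adm-last  : (u : Word) (k′ : ℕ) (m : ℚ) .(p : Positive m) →
              Admissible (u ∷ʳ y (suc k′) m p)

-- Partial fractions:  1/((x+m₁)^e₁ (x+m₂)^e₂)  for m₁ ≠ m₂ , written as
-- a ℚ-linear combination of  1/(x+m₁)^i  and  1/(x+m₂)^j , using
--   1/(A^e₁ B^e₂) = (1/(m₂-m₁)) (1/(A^e₁ B^(e₂-1)) - 1/(A^(e₁-1) B^e₂))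
-- with A = x+m₁, B = x+m₂.  A term (q , l) stands for q · l.


-- total inverse on ℚ (only ever used at nonzero arguments below)
inv : ℚ → ℚ
inv q with q ℚ.≟ ℚ.0ℚ
... | yes _ = ℚ.0ℚ
... | no q≢0 = ℚ.1/_ q {{ ℚ.≢-nonZero q≢0 }}

module _ (m₁ m₂ : ℚ) .(p₁ : Positive m₁) .(p₂ : Positive m₂) where
  private
    c : ℚ
    c = inv (m₂ ℚ.- m₁)
    sc : ℚ → ℚ × Letter → ℚ × Letter
    sc q (r , l) = (q ℚ.* r , l)

  partialFraction : ℕ → ℕ → List (ℚ × Letter)
  partialFraction zero    zero    = []
  partialFraction (suc a) zero    = (ℚ.1ℚ , y a m₁ p₁) ∷ []
  partialFraction zero    (suc b) = (ℚ.1ℚ , y b m₂ p₂) ∷ []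
  partialFraction (suc a) (suc b) =
    map (sc c) (partialFraction (suc a) b) ++
    map (sc (ℚ.- c)) (partialFraction a (suc b))

_⊙_ : Letter → Letter → List (ℚ × Letter)
y a m₁ p₁ ⊙ y b m₂ p₂ with m₁ ℚ.≟ m₂
... | yes _ = (ℚ.1ℚ , y (suc (a ℕ.+ b)) m₁ p₁) ∷ []       -- y_{a+1+b+1, m}
... | no  _ = partialFraction m₁ m₂ p₁ p₂ (suc a) (suc b)

-- The free module  R⟨Y⟩  over a commutative ring R which is a ℚ-algebra
-- via ι : ℚ → R, with a fixed element μ ∈ R.  (In the paper R = ℚ[μ] ⊂ ℂ.)
-- Elements are finite formal sums  Σ cᵢ wᵢ , represented as lists of
-- (coefficient , word); equality ≋ compares the coefficient of every word.

module Setup {c ℓ : Level} (R : CommutativeRing c ℓ) (ι : ℚ → CommutativeRing.Carrier R)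
             (μ : CommutativeRing.Carrier R) where

  open CommutativeRing R

  Elt : Set c
  Elt = List (Carrier × Word)

  coeff : Word → Elt → Carrier
  coeff w [] = 0#
  coeff w ((r , v) ∷ a) = (if v ==ʷ w then r else 0#) + coeff w a

  infix 4 _≋_
  _≋_ : Elt → Elt → Set ℓ
  a ≋ b = ∀ w → coeff w a ≈ coeff w b

  zeroE : Elt
  zeroE = []

  oneE : Elt
  oneE = (1# , []) ∷ []

  _⊕_ : Elt → Elt → Elt
  a ⊕ b = a ++ b

  _·_ : Carrier → Elt → Elt
  r · a = map (λ { (s , w) → (r * s , w) }) a

  ⟨_⟩ : Word → Elt
  ⟨ w ⟩ = (1# , w) ∷ []

  -- μ-stuffle on words, computed on reversed words (head = last letter)
  private
    stuffleRev : Word → Word → Elt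
    stuffleRev [] v = (1# , v) ∷ []
    stuffleRev (x ∷ u) [] = (1# , x ∷ u) ∷ []
    stuffleRev (x ∷ u) (z ∷ v) =
      map (λ { (r , w) → (r , x ∷ w) }) (stuffleRev u (z ∷ v)) ++
      map (λ { (r , w) → (r , z ∷ w) }) (stuffleRev (x ∷ u) v) ++
      concatMap (λ { (r , w) → map (λ { (q , l) → ((- μ) * (r * ι q) , l ∷ w) }) (x ⊙ z) })
                (stuffleRev u v)

  -- ux ∗ vz = (u ∗ vz)x + (ux ∗ v)z − μ (u ∗ v)(x ⊙ z)
  stuffleWord : Word → Word → Elt
  stuffleWord u v = map (λ { (r , w) → (r , reverse w) }) (stuffleRev (reverse u) (reverse v))

  infixl 7 _∗_
  _∗_ : Elt → Elt → Elt
  a ∗ b = concatMap (λ { (r , u) → concatMap (λ { (s , v) → (r * s) · stuffleWord u v }) b }) a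

  data Gen⁰ : Set where
    admissible      : (w : Word) → Admissible w → Gen⁰
    quasiAdmissible : (u : Word) (m m̃ : ℚ) .(p : Positive m) .(p̃ : Positive m̃) → m ≢ m̃ → Gen⁰

  ⟦_⟧⁰ : Gen⁰ → Elt
  ⟦ admissible w _ ⟧⁰ = ⟨ w ⟩
  ⟦ quasiAdmissible u m m̃ p p̃ _ ⟧⁰ = (1# , u ∷ʳ y 0 m p) ∷ (- 1# , u ∷ʳ y 0 m̃ p̃) ∷ []

  InY⁰ : Elt → Set (c ⊔ ℓ)
  InY⁰ a = Σ (List (Carrier × Gen⁰)) λ gs →
             a ≋ concatMap (λ { (r , g) → r · ⟦ g ⟧⁰ }) gs

  -- Polynomials  Σ wᵢ Tⁱ  with coefficients in R⟨Y⟩ : coefficient lists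
  -- (w₀ ∷ w₁ ∷ …).  Membership in R⟨Y⟩⁰[T] : All InY⁰.

  Poly : Set c
  Poly = List Elt

  coeffT : ℕ → Poly → Elt
  coeffT _       []      = zeroE
  coeffT zero    (a ∷ _) = a
  coeffT (suc i) (_ ∷ P) = coeffT i P

  infix 4 _≋ₚ_
  _≋ₚ_ : Poly → Poly → Set ℓ
  P ≋ₚ Q = ∀ i → coeffT i P ≋ coeffT i Q

  _+ₚ_ : Poly → Poly → Poly
  []      +ₚ Q       = Q
  (a ∷ P) +ₚ []      = a ∷ P
  (a ∷ P) +ₚ (b ∷ Q) = (a ⊕ b) ∷ (P +ₚ Q)

  _*ₚ_ : Poly → Poly → Poly
  []      *ₚ Q = []
  (a ∷ P) *ₚ Q = map (a ∗_) Q +ₚ (zeroE ∷ (P *ₚ Q))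

  oneₚ : Poly
  oneₚ = oneE ∷ []

  _^∗_ : Elt → ℕ → Elt
  a ^∗ zero  = oneE
  a ^∗ suc i = a ∗ (a ^∗ i)

  y₁ : (m : ℚ) → .(Positive m) → Elt
  y₁ m p = ⟨ y 0 m p ∷ [] ⟩

  module _ (m : ℚ) .(p : Positive m) where
    ψFrom : ℕ → Poly → Elt
    ψFrom i []      = zeroE
    ψFrom i (w ∷ P) = (w ∗ (y₁ m p ^∗ i)) ⊕ ψFrom (suc i) P

    ψ : Poly → Elt
    ψ = ψFrom 0

  record IsY⁰AlgebraIso (f : Poly → Elt) : Set (c ⊔ ℓ) where
    field
      well-defined : ∀ P Q → All InY⁰ P → All InY⁰ Q → P ≋ₚ Q → f P ≋ f Q
      additive     : ∀ P Q → All InY⁰ P → All InY⁰ Q → f (P +ₚ Q) ≋ f P ⊕ f Q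
      multiplicative : ∀ P Q → All InY⁰ P → All InY⁰ Q → f (P *ₚ Q) ≋ f P ∗ f Q
      unital       : f oneₚ ≋ oneE
      Y⁰-linear    : ∀ w P → InY⁰ w → All InY⁰ P → f (map (w ∗_) P) ≋ w ∗ f P
      injective    : ∀ P Q → All InY⁰ P → All InY⁰ Q → f P ≋ f Q → P ≋ₚ Q
      surjective   : ∀ a → Σ Poly λ P → All InY⁰ P × f P ≋ a

{-# OPTIONS --safe #-}
module Submission where

-- Let π delete the last letter of a word when it is some y_{1,n}, and kill
-- every other word.  Since the residues of 1/((x+m)^a (x+n)^b) sum to zero,
-- the term with ⊙ is killed by π, so π is a derivation for ∗.  Its kernel is
-- Y⁰, it is locally nilpotent, and π y_{1,m} = 1.  A locally nilpotent
-- derivation with such a slice, over a ℚ-algebra, makes the algebra the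
-- polynomial ring in the slice over the kernel: differentiate to see that the
-- coefficients of a polynomial are determined by its value, and integrate to
-- reach every element.
--
-- An element is handled through its pairings with all functionals on words.
-- Associativity of ⊙ comes from the resolvent identity
-- (n − m) D_m D_n = D_m − D_n for the division operators D_m = 1/(x+m).

open import Defs
open import Level using (Level; _⊔_)
open import Data.Nat as ℕ using (ℕ; zero; suc)
import Data.Nat.Properties as ℕₚ
open import Data.Rational as ℚ using (ℚ; Positive; +-*-rawRing)
import Data.Rational.Properties as ℚₚ
open import Data.Bool using (true; false; if_then_else_)
open import Data.List using (List; []; _∷_; _++_; map; concatMap; reverse; _∷ʳ_; length)
open import Data.List.Properties using (reverse-involutive; unfold-reverse; reverse-++; map-++; ++-assoc)
open import Data.List.Membership.Propositional using (_∈_)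
open import Data.List.Membership.Propositional.Properties using (∈-++⁺ˡ; ∈-++⁺ʳ)
open import Data.List.Relation.Unary.Any using (here; there)
open import Data.List.Relation.Unary.All as All using (All; []; _∷_)
open import Data.Maybe using (Maybe; just; nothing)
open import Data.Product using (_×_; _,_; Σ; proj₁; proj₂)
open import Relation.Nullary using (Dec; yes; no; contradiction)
open import Relation.Binary.PropositionalEquality as ≡ using (_≡_; _≢_)
open import Relation.Binary.Structures using (IsEquivalence)
import Relation.Binary.Reasoning.Setoid as SetoidReasoning
open import Algebra.Bundles using (CommutativeRing; CommutativeSemiring)
open import Algebra.Morphism.Structures using (IsRingHomomorphism)
import Algebra.Properties.Group as GroupProperties
import Algebra.Properties.Ring as RingProperties
import Algebra.Solver.Ring as RingSolver
import Algebra.Solver.Ring.NaturalCoefficients.Default as SemiringSolver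
open import Algebra.Solver.Ring.AlmostCommutativeRing using (fromCommutativeRing; _-Raw-AlmostCommutative⟶_)
import Algebra.Structures.Biased as Biased

-- Formal sums are unreduced lists over an arbitrary ring, so cancellation in them is hard to follow
-- coefficient by coefficient. Pairing with every functional turns an identity of sums into an
-- equation in `R`. Since `v ↦ ⟪ stuffleWord u v , φ ⟫` is again a functional, pairings nest, and
-- each operation on sums can be replaced by its transpose on functionals. The same device stands in
-- for rational functions, which are never constructed: a functional on letters is read as a
-- functional on fractions, and division by x+m becomes an operator on such functionals. Residues
-- sum to zero because a product of two letters decays at least like the inverse square of x at
-- infinity. As π forgets n when it deletes y_{1,n}, its kernel must contain the differences of two
-- words that differ only in this n; this is where the quasi-admissible elements come from. Words
-- are mostly handled reversed, because both the product and π act on the last letter.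

==ˡ-refl : ∀ a → (a ==ˡ a) ≡ true
==ˡ-refl a with k-1 a ℕ.≟ k-1 a | m a ℚ.≟ m a
... | yes _ | yes _ = ≡.refl
... | yes _ | no n≢ = contradiction ≡.refl n≢
... | no k≢ | _     = contradiction ≡.refl k≢

==ˡ-sound : ∀ a b → (a ==ˡ b) ≡ true → a ≡ b
==ˡ-sound (y k n p) (y k′ n′ p′) eq with k ℕ.≟ k′ | n ℚ.≟ n′
==ˡ-sound (y k n p) (y k′ n′ p′) eq | yes ≡.refl | yes ≡.refl = ≡.refl

==ʷ-refl : ∀ w → (w ==ʷ w) ≡ true
==ʷ-refl []      = ≡.refl
==ʷ-refl (a ∷ w) rewrite ==ˡ-refl a = ==ʷ-refl w

==ʷ-sound : ∀ v w → (v ==ʷ w) ≡ true → v ≡ w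
==ʷ-sound []      []      eq = ≡.refl
==ʷ-sound (a ∷ v) (b ∷ w) eq with a ==ˡ b in a≡b
... | true = ≡.cong₂ _∷_ (==ˡ-sound a b a≡b) (==ʷ-sound v w eq)

*-inv : ∀ q → q ≢ ℚ.0ℚ → q ℚ.* inv q ≡ ℚ.1ℚ
*-inv q q≢0 with q ℚ.≟ ℚ.0ℚ
... | yes q≡0 = contradiction q≡0 q≢0
... | no  q≢0 = ℚₚ.*-inverseʳ q {{ℚ.≢-nonZero q≢0}}

-- Positivity is proof-irrelevant, so equal values give equal records, and a goal about two poles
-- can be transported to the case where they coincide.
record ℚ⁺ : Set where
  constructor pos
  field
    val : ℚ
    .val>0 : Positive val
open ℚ⁺ using (val)

val-injective : ∀ {q r : ℚ⁺} → val q ≡ val r → q ≡ r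
val-injective ≡.refl = ≡.refl

⊙-same : ∀ a b m .(p : Positive m) → y a m p ⊙ y b m p ≡ (ℚ.1ℚ , y (suc (a ℕ.+ b)) m p) ∷ []
⊙-same a b m p with m ℚ.≟ m
... | yes _  = ≡.refl
... | no m≢m = contradiction ≡.refl m≢m

⊙-distinct : ∀ a b m n .(p : Positive m) .(q : Positive n) → m ≢ n →
             y a m p ⊙ y b n q ≡ partialFraction m n p q (suc a) (suc b)
⊙-distinct a b m n p q m≢n with m ℚ.≟ n
... | yes m≡n = contradiction m≡n m≢n
... | no  _   = ≡.refl

natℚ : ℕ → ℚ
natℚ zero    = ℚ.0ℚ
natℚ (suc n) = ℚ.1ℚ ℚ.+ natℚ n

natℚ-nonneg : ∀ n → ℚ.0ℚ ℚ.≤ natℚ n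
natℚ-nonneg zero    = ℚₚ.≤-refl
natℚ-nonneg (suc n) = ℚₚ.+-mono-≤ (ℚₚ.nonNegative⁻¹ ℚ.1ℚ) (natℚ-nonneg n)

-- Integration of polynomials divides by exponents. Their inverses are taken in ℚ, where
-- nonvanishing follows from the order, and are carried to `R` by `ι`.
natℚ-suc≢0 : ∀ n → natℚ (suc n) ≢ ℚ.0ℚ
natℚ-suc≢0 n eq = ℚₚ.<⇒≢ (ℚₚ.+-mono-<-≤ (ℚₚ.positive⁻¹ ℚ.1ℚ) (natℚ-nonneg n)) (≡.sym eq)

module StuffleAlgebra {c ℓ : Level} (R : CommutativeRing c ℓ) (ι : ℚ → CommutativeRing.Carrier R)
  (ι-hom : IsRingHomomorphism +-*-rawRing (CommutativeRing.rawRing R) ι)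
  (μ : CommutativeRing.Carrier R) where

  open CommutativeRing R hiding (zero)
  open RingProperties ring using (-1*x≈-x)
  open Setup R ι μ
  open SetoidReasoning setoid
  open IsRingHomomorphism ι-hom using (+-homo; *-homo; -‿homo; 0#-homo; 1#-homo)

  private
    ι-morphism : +-*-rawRing -Raw-AlmostCommutative⟶ fromCommutativeRing R
    ι-morphism = record
      { ⟦_⟧ = ι ; +-homo = +-homo ; *-homo = *-homo ; -‿homo = -‿homo
      ; 0-homo = 0#-homo ; 1-homo = 1#-homo }

    ι-≟ : ∀ p q → Maybe (ι p ≈ ι q)
    ι-≟ p q with p ℚ.≟ q
    ... | yes p≡q = just (reflexive (≡.cong ι p≡q))
    ... | no  _   = nothing

  open RingSolver +-*-rawRing (fromCommutativeRing R) ι-morphism ι-≟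
    using (solve; _:=_; _:+_; _:*_; _:-_; :-_)

  -- Pairing formal sums with functionals

  ⟪_,_⟫ : {A : Set} → List (Carrier × A) → (A → Carrier) → Carrier
  ⟪ [] , φ ⟫          = 0#
  ⟪ (r , x) ∷ a , φ ⟫ = r * φ x + ⟪ a , φ ⟫

  private
    variable
      A B : Set

  pair-cong : (a : List (Carrier × A)) {φ χ : A → Carrier} → (∀ x → φ x ≈ χ x) → ⟪ a , φ ⟫ ≈ ⟪ a , χ ⟫
  pair-cong []            eq = refl
  pair-cong ((r , x) ∷ a) eq = +-cong (*-congˡ (eq x)) (pair-cong a eq)

  pair-++ : (a b : List (Carrier × A)) (φ : A → Carrier) → ⟪ a ++ b , φ ⟫ ≈ ⟪ a , φ ⟫ + ⟪ b , φ ⟫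
  pair-++ []            b φ = sym (+-identityˡ _)
  pair-++ ((r , x) ∷ a) b φ = trans (+-congˡ (pair-++ a b φ)) (sym (+-assoc _ _ _))

  pair-0 : (a : List (Carrier × A)) {φ : A → Carrier} → (∀ x → φ x ≈ 0#) → ⟪ a , φ ⟫ ≈ 0#
  pair-0 []            eq = refl
  pair-0 ((r , x) ∷ a) eq = trans (+-cong (trans (*-congˡ (eq x)) (zeroʳ r)) (pair-0 a eq)) (+-identityˡ 0#)

  pair-+ : (a : List (Carrier × A)) (φ χ : A → Carrier) → ⟪ a , (λ x → φ x + χ x) ⟫ ≈ ⟪ a , φ ⟫ + ⟪ a , χ ⟫
  pair-+ []            φ χ = sym (+-identityˡ 0#)
  pair-+ ((r , x) ∷ a) φ χ = trans (+-congˡ (pair-+ a φ χ))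
    (solve 5 (λ r f g s t → r :* (f :+ g) :+ (s :+ t) := (r :* f :+ s) :+ (r :* g :+ t)) refl
      r (φ x) (χ x) ⟪ a , φ ⟫ ⟪ a , χ ⟫)

  pair-* : (a : List (Carrier × A)) (s : Carrier) (φ : A → Carrier) → ⟪ a , (λ x → s * φ x) ⟫ ≈ s * ⟪ a , φ ⟫
  pair-* []            s φ = sym (zeroʳ s)
  pair-* ((r , x) ∷ a) s φ = trans (+-congˡ (pair-* a s φ))
    (solve 4 (λ r s f t → r :* (s :* f) :+ s :* t := s :* (r :* f :+ t)) refl r s (φ x) ⟪ a , φ ⟫)

  pair-swap : (a : List (Carrier × A)) (b : List (Carrier × B)) (φ : A → B → Carrier) →
              ⟪ a , (λ x → ⟪ b , φ x ⟫) ⟫ ≈ ⟪ b , (λ z → ⟪ a , (λ x → φ x z) ⟫) ⟫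
  pair-swap []            b φ = sym (pair-0 b (λ _ → refl))
  pair-swap ((r , x) ∷ a) b φ = begin
    r * ⟪ b , φ x ⟫ + ⟪ a , (λ x → ⟪ b , φ x ⟫) ⟫                    ≈⟨ +-cong (sym (pair-* b r (φ x))) (pair-swap a b φ) ⟩
    ⟪ b , (λ z → r * φ x z) ⟫ + ⟪ b , (λ z → ⟪ a , (λ x → φ x z) ⟫) ⟫ ≈⟨ pair-+ b _ _ ⟨
    ⟪ b , (λ z → r * φ x z + ⟪ a , (λ x → φ x z) ⟫) ⟫                ∎

  -- Stated for an arbitrary `f` with a termwise condition: the functions mapped over lists in the
  -- definitions are anonymous, and unification supplies them.
  pair-map : (f : Carrier × A → Carrier × B) {φ : B → Carrier} (χ : A → Carrier) →
             (∀ r x → proj₁ (f (r , x)) * φ (proj₂ (f (r , x))) ≈ r * χ x) →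
             ∀ a → ⟪ map f a , φ ⟫ ≈ ⟪ a , χ ⟫
  pair-map f χ eq []            = refl
  pair-map f χ eq ((r , x) ∷ a) = +-cong (eq r x) (pair-map f χ eq a)

  pair-concatMap : (f : Carrier × A → List (Carrier × B)) {φ : B → Carrier} (χ : A → Carrier) →
                   (∀ r x → ⟪ f (r , x) , φ ⟫ ≈ r * χ x) →
                   ∀ a → ⟪ concatMap f a , φ ⟫ ≈ ⟪ a , χ ⟫
  pair-concatMap f χ eq []            = refl
  pair-concatMap f χ eq ((r , x) ∷ a) =
    trans (pair-++ (f (r , x)) _ _) (+-cong (eq r x) (pair-concatMap f χ eq a))

  pair-· : ∀ r a φ → ⟪ r · a , φ ⟫ ≈ r * ⟪ a , φ ⟫
  pair-· r a φ = trans (pair-map _ (λ w → r * φ w) (λ s w → solve 3 (λ r s f → r :* s :* f := s :* (r :* f)) refl r s (φ w)) a)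
                       (pair-* a r φ)

  pair-single : (x : A) (φ : A → Carrier) → ⟪ (1# , x) ∷ [] , φ ⟫ ≈ φ x
  pair-single x φ = trans (+-identityʳ _) (*-identityˡ _)

  infix 4 _≃_
  record _≃_ (a b : Elt) : Set (c ⊔ ℓ) where
    constructor mk≃
    field at : ∀ φ → ⟪ a , φ ⟫ ≈ ⟪ b , φ ⟫
  open _≃_ public

  δ : Word → Word → Carrier
  δ w v = if v ==ʷ w then 1# else 0#

  coeff≈pair-δ : ∀ w a → coeff w a ≈ ⟪ a , δ w ⟫
  coeff≈pair-δ w []            = refl
  coeff≈pair-δ w ((r , v) ∷ a) with v ==ʷ w
  ... | true  = +-cong (sym (*-identityʳ r)) (coeff≈pair-δ w a)
  ... | false = +-cong (sym (zeroʳ r)) (coeff≈pair-δ w a)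

  ≃⇒≋ : ∀ {a b} → a ≃ b → a ≋ b
  ≃⇒≋ {a} {b} a≃b w = trans (coeff≈pair-δ w a) (trans (at a≃b (δ w)) (sym (coeff≈pair-δ w b)))

  -- Subtracting `restrict vs φ v` before adding the multiple of `δ v` prevents a word that is
  -- repeated in the list from being counted twice.
  restrict : List Word → (Word → Carrier) → Word → Carrier
  restrict []       φ w = 0#
  restrict (v ∷ vs) φ w = δ v w * (φ v - restrict vs φ v) + restrict vs φ w

  restrict-∈ : ∀ vs φ w → w ∈ vs → restrict vs φ w ≈ φ w
  restrict-∈ (v ∷ vs) φ w w∈ with w ==ʷ v in eq
  ... | true with ==ʷ-sound w v eq
  ...   | ≡.refl = trans (+-congʳ (*-identityˡ _)) (solve 2 (λ a b → a :- b :+ b := a) refl (φ w) (restrict vs φ w))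
  restrict-∈ (v ∷ vs) φ w (here ≡.refl) | false with () ← ≡.trans (≡.sym eq) (==ʷ-refl w)
  restrict-∈ (v ∷ vs) φ w (there w∈) | false =
    trans (+-congʳ (zeroˡ _)) (trans (+-identityˡ _) (restrict-∈ vs φ w w∈))

  pair-restrict : ∀ vs φ a → (∀ {w} → w ∈ map proj₂ a → w ∈ vs) → ⟪ a , restrict vs φ ⟫ ≈ ⟪ a , φ ⟫
  pair-restrict vs φ []            sub = refl
  pair-restrict vs φ ((r , w) ∷ a) sub =
    +-cong (*-congˡ (restrict-∈ vs φ w (sub (here ≡.refl)))) (pair-restrict vs φ a (λ i → sub (there i)))

  ≋⇒pair-restrict : ∀ {a b} → a ≋ b → ∀ vs φ → ⟪ a , restrict vs φ ⟫ ≈ ⟪ b , restrict vs φ ⟫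
  ≋⇒pair-restrict {a} {b} a≋b []       φ = trans (pair-0 a (λ _ → refl)) (sym (pair-0 b (λ _ → refl)))
  ≋⇒pair-restrict {a} {b} a≋b (v ∷ vs) φ =
    trans (split a) (trans (+-cong (*-congˡ (a≋b v)) (≋⇒pair-restrict {a} {b} a≋b vs φ)) (sym (split b)))
    where
    t : Carrier
    t = φ v - restrict vs φ v
    split : ∀ e → ⟪ e , restrict (v ∷ vs) φ ⟫ ≈ t * coeff v e + ⟪ e , restrict vs φ ⟫
    split e = trans (pair-+ e _ _) (+-congʳ (trans (pair-cong e (λ _ → *-comm _ t))
      (trans (pair-* e t (δ v)) (*-congˡ (sym (coeff≈pair-δ v e))))))

  -- Only the finitely many words occurring in a and b matter, and there a
  -- functional is a combination of the coordinate functionals δ.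
  ≋⇒≃ : ∀ {a b} → a ≋ b → a ≃ b
  ≋⇒≃ {a} {b} a≋b .at φ =
    trans (sym (pair-restrict vs φ a ∈-++⁺ˡ))
      (trans (≋⇒pair-restrict {a} {b} a≋b vs φ) (pair-restrict vs φ b (∈-++⁺ʳ (map proj₂ a))))
    where
    vs : List Word
    vs = map proj₂ a ++ map proj₂ b

  -- Partial fractions

  -- A functional φ on the letters is viewed as φ k n = φ(1/(x+n)^k), with a
  -- junk value at k = 0; E m φ is φ precomposed with multiplication by
  -- 1/(x+m), and it does not depend on φ at k = 0.
  Functional : Set c
  Functional = ℕ → ℚ⁺ → Carrier

  E : ℚ⁺ → Functional → Functional
  -- The fraction `1/(x+n)^0` is the constant 1 whatever `n` is, and its product with `1/(x+m)` is
  -- `1/(x+m)`. So after one application the entry at exponent 0 is meaningful.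
  E m φ zero    n = φ 1 m
  E m φ (suc k) n with val m ℚ.≟ val n
  ... | yes _ = φ (suc (suc k)) m
  -- With A = x+m and B = x+n, this is (B - A)/(A B^(k+1)) = 1/(A B^k) - 1/B^(k+1), where B - A = n
  -- - m.
  ... | no  _ = ι (inv (val n ℚ.- val m)) * (E m φ k n - φ (suc k) n)

  difference-unit : ∀ p q → p ≢ q → (ι q - ι p) * ι (inv (q ℚ.- p)) ≈ 1#
  difference-unit p q p≢q = begin
    (ι q - ι p) * ι (inv (q ℚ.- p))       ≈⟨ *-congʳ (sym (trans (+-homo _ _) (+-congˡ (-‿homo p)))) ⟩
    ι (q ℚ.- p) * ι (inv (q ℚ.- p))       ≈⟨ *-homo _ _ ⟨
    ι ((q ℚ.- p) ℚ.* inv (q ℚ.- p))       ≡⟨ ≡.cong ι (*-inv (q ℚ.- p) (λ q-p≡0 → p≢q (≡.sym (q-p≡0⇒q≡p q-p≡0)))) ⟩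
    ι ℚ.1ℚ                                ≈⟨ 1#-homo ⟩
    1#                                    ∎
    where q-p≡0⇒q≡p = GroupProperties.x∙y⁻¹≈ε⇒x≈y ℚₚ.+-0-group q p

  -- `R` may have zero divisors, but a nonzero difference of rationals has a unit as its image.
  -- Hence the recursion for `E` can be used with denominators cleared, as in `E-distinct`.
  difference-cancel : ∀ {p q} → p ≢ q → ∀ {r s} → (ι q - ι p) * r ≈ (ι q - ι p) * s → r ≈ s
  difference-cancel {p} {q} p≢q {r} {s} eq = trans (sym (undo r)) (trans (*-congˡ eq) (undo s))
    where
    undo : ∀ t → ι (inv (q ℚ.- p)) * ((ι q - ι p) * t) ≈ t
    undo t = trans (sym (*-assoc _ _ _))
      (trans (*-congʳ (trans (*-comm _ _) (difference-unit p q p≢q))) (*-identityˡ t))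

  E-same : ∀ m φ k → E m φ k m ≈ φ (suc k) m
  E-same m φ zero = refl
  E-same m φ (suc k) with val m ℚ.≟ val m
  ... | yes _  = refl
  ... | no m≢m = contradiction ≡.refl m≢m

  E-distinct : ∀ m n φ k → val m ≢ val n →
               (ι (val n) - ι (val m)) * E m φ (suc k) n ≈ E m φ k n - φ (suc k) n
  E-distinct m n φ k m≢n with val m ℚ.≟ val n
  ... | yes m≡n = contradiction m≡n m≢n
  ... | no  _   = trans (sym (*-assoc _ _ _))
    (trans (*-congʳ (difference-unit (val m) (val n) m≢n)) (*-identityˡ _))

  -- Agreement is asked for at positive exponents only, because `functional` puts the filler `0#` at
  -- exponent 0 while the functionals it is compared with need not vanish there.
  E-cong : ∀ m {φ χ} → (∀ k n → φ (suc k) n ≈ χ (suc k) n) → ∀ k n → E m φ k n ≈ E m χ k n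
  E-cong m eq zero    n = eq 0 m
  E-cong m eq (suc k) n with val m ℚ.≟ val n
  ... | yes _ = eq (suc k) m
  ... | no  _ = *-congˡ (+-cong (E-cong m eq k n) (-‿cong (eq k n)))

  -- For fractions this is (x+n) - (x+m) = n - m divided by (x+m)(x+n). It is tested on `1/(x+l)^k`
  -- by induction on `k`; the cases follow the recursion for `E`, which behaves differently when `l`
  -- is one of the poles `m`, `n`.
  E-resolvent : ∀ m n φ → val m ≢ val n → ∀ k l →
                (ι (val n) - ι (val m)) * E m (E n φ) k l ≈ E m φ k l - E n φ k l
  E-resolvent m n φ m≢n zero l = begin
    (ι (val n) - ι (val m)) * E n φ 1 m      ≈⟨ solve 3 (λ a b x → (a :- b) :* x := :- ((b :- a) :* x)) refl (ι (val n)) (ι (val m)) _ ⟩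
    - ((ι (val m) - ι (val n)) * E n φ 1 m)  ≈⟨ -‿cong (E-distinct n m φ 0 (λ n≡m → m≢n (≡.sym n≡m))) ⟩
    - (φ 1 n - φ 1 m)                        ≈⟨ solve 2 (λ a b → :- (a :- b) := b :- a) refl (φ 1 n) (φ 1 m) ⟩
    φ 1 m - φ 1 n                            ∎
  E-resolvent m n φ m≢n (suc k) l = split (val m ℚ.≟ val l) (val n ℚ.≟ val l)
    where
    n≢m : val n ≢ val m
    n≢m n≡m = m≢n (≡.sym n≡m)

    Goal : ℚ⁺ → Set ℓ
    Goal l = (ι (val n) - ι (val m)) * E m (E n φ) (suc k) l ≈ E m φ (suc k) l - E n φ (suc k) l

    at-m : Goal m
    at-m = begin
      (ι (val n) - ι (val m)) * E m (E n φ) (suc k) m          ≈⟨ *-congˡ (E-same m (E n φ) (suc k)) ⟩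
      (ι (val n) - ι (val m)) * E n φ (suc (suc k)) m          ≈⟨ solve 3 (λ a b x → (a :- b) :* x := :- ((b :- a) :* x)) refl (ι (val n)) (ι (val m)) _ ⟩
      - ((ι (val m) - ι (val n)) * E n φ (suc (suc k)) m)      ≈⟨ -‿cong (E-distinct n m φ (suc k) n≢m) ⟩
      - (E n φ (suc k) m - φ (suc (suc k)) m)                  ≈⟨ solve 2 (λ a b → :- (a :- b) := b :- a) refl _ _ ⟩
      φ (suc (suc k)) m - E n φ (suc k) m                      ≈⟨ +-congʳ (E-same m φ (suc k)) ⟨
      E m φ (suc k) m - E n φ (suc k) m                        ∎

    at-n : Goal n
    at-n = trans (E-distinct m n (E n φ) k m≢n) (+-congʳ (difference-cancel m≢n (begin
      (ι (val n) - ι (val m)) * E m (E n φ) k n     ≈⟨ E-resolvent m n φ m≢n k n ⟩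
      E m φ k n - E n φ k n                         ≈⟨ +-congˡ (-‿cong (E-same n φ k)) ⟩
      E m φ k n - φ (suc k) n                       ≈⟨ E-distinct m n φ k m≢n ⟨
      (ι (val n) - ι (val m)) * E m φ (suc k) n     ∎)))

    -- Multiplying by l - m unwinds `E m` by one exponent, which makes the induction hypothesis
    -- applicable. The term `E n φ k l` that it leaves is raised back to exponent `suc k` by the
    -- recursion for `E n`.
    elsewhere : val m ≢ val l → val n ≢ val l → Goal l
    elsewhere m≢l n≢l = difference-cancel m≢l (begin
      (L - M) * ((N - M) * E m (E n φ) (suc k) l)
        ≈⟨ solve 3 (λ a b x → a :* (b :* x) := b :* (a :* x)) refl (L - M) (N - M) _ ⟩
      (N - M) * ((L - M) * E m (E n φ) (suc k) l)
        ≈⟨ *-congˡ (E-distinct m l (E n φ) k m≢l) ⟩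
      (N - M) * (E m (E n φ) k l - e)
        ≈⟨ solve 3 (λ a x e → a :* (x :- e) := a :* x :- a :* e) refl (N - M) _ e ⟩
      (N - M) * E m (E n φ) k l - (N - M) * e
        ≈⟨ +-congʳ (E-resolvent m n φ m≢n k l) ⟩
      E m φ k l - E n φ k l - (N - M) * e
        ≈⟨ +-congʳ (+-congˡ (-‿cong Eφkl≈)) ⟩
      E m φ k l - ((L - N) * e + f) - (N - M) * e
        ≈⟨ solve 6 (λ L N M e f d → d :- ((L :- N) :* e :+ f) :- (N :- M) :* e := (d :- f) :- (L :- M) :* e) refl L N M e f _ ⟩
      (E m φ k l - f) - (L - M) * e
        ≈⟨ +-congʳ (E-distinct m l φ k m≢l) ⟨
      (L - M) * E m φ (suc k) l - (L - M) * e
        ≈⟨ solve 3 (λ a x e → a :* x :- a :* e := a :* (x :- e)) refl (L - M) _ e ⟩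
      (L - M) * (E m φ (suc k) l - e) ∎)
      where
      L = ι (val l)
      M = ι (val m)
      N = ι (val n)
      e = E n φ (suc k) l
      f = φ (suc k) l
      Eφkl≈ : E n φ k l ≈ (L - N) * e + f
      Eφkl≈ = trans (solve 2 (λ a f → a := a :- f :+ f) refl (E n φ k l) f)
                    (+-congʳ (sym (E-distinct n l φ k n≢l)))

    split : Dec (val m ≡ val l) → Dec (val n ≡ val l) → Goal l
    split (yes m≡l) _         = ≡.subst Goal (val-injective m≡l) at-m
    split (no _)    (yes n≡l) = ≡.subst Goal (val-injective n≡l) at-n
    split (no m≢l)  (no n≢l)  = elsewhere m≢l n≢l

  -- In the resolvent identity both the factor n - m and the right side change sign when `m` and `n`
  -- are exchanged, so the composite is symmetric.
  E-comm : ∀ m n φ k l → E m (E n φ) k l ≈ E n (E m φ) k l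
  E-comm m n φ k l with val m ℚ.≟ val n
  ... | yes m≡n with ≡.refl ← val-injective {m} {n} m≡n = refl
  ... | no  m≢n = difference-cancel m≢n (begin
    (ι (val n) - ι (val m)) * E m (E n φ) k l       ≈⟨ E-resolvent m n φ m≢n k l ⟩
    E m φ k l - E n φ k l                           ≈⟨ solve 2 (λ a b → a :- b := :- (b :- a)) refl _ _ ⟩
    - (E n φ k l - E m φ k l)                       ≈⟨ -‿cong (E-resolvent n m φ (λ n≡m → m≢n (≡.sym n≡m)) k l) ⟨
    - ((ι (val m) - ι (val n)) * E n (E m φ) k l)   ≈⟨ solve 3 (λ a b x → :- ((b :- a) :* x) := (a :- b) :* x) refl (ι (val n)) (ι (val m)) _ ⟩
    (ι (val n) - ι (val m)) * E n (E m φ) k l       ∎)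

  E^ : ℕ → ℚ⁺ → Functional → Functional
  E^ zero    m φ = φ
  E^ (suc a) m φ = E m (E^ a m φ)

  E^-cong : ∀ a m {φ χ} → (∀ k n → φ (suc k) n ≈ χ (suc k) n) → ∀ k n → E^ a m φ (suc k) n ≈ E^ a m χ (suc k) n
  E^-cong zero    m eq k n = eq k n
  E^-cong (suc a) m eq k n = E-cong m (E^-cong a m eq) (suc k) n

  E-E^-comm : ∀ a m n φ k l → E n (E^ a m φ) k l ≈ E^ a m (E n φ) k l
  E-E^-comm zero    m n φ k l = refl
  E-E^-comm (suc a) m n φ k l = trans (E-comm n m (E^ a m φ) k l) (E-cong m (λ k → E-E^-comm a m n φ (suc k)) k l)

  E^-comm : ∀ a b m n φ k l → E^ b n (E^ a m φ) k l ≈ E^ a m (E^ b n φ) k l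
  E^-comm a zero    m n φ k l = refl
  E^-comm a (suc b) m n φ k l =
    trans (E-cong n (λ k → E^-comm a b m n φ (suc k)) k l) (E-E^-comm a m n (E^ b n φ) k l)

  E^-same : ∀ a m φ k → E^ a m φ k m ≈ φ (k ℕ.+ a) m
  E^-same zero    m φ k = reflexive (≡.cong (λ j → φ j m) (≡.sym (ℕₚ.+-identityʳ k)))
  E^-same (suc a) m φ k = trans (E-same m (E^ a m φ) k)
    (trans (E^-same a m φ (suc k)) (reflexive (≡.cong (λ j → φ j m) (≡.sym (ℕₚ.+-suc k a)))))

  E^-at-0 : ∀ a m φ l → E^ (suc a) m φ 0 l ≈ φ (suc a) m
  E^-at-0 a m φ l = E^-same a m φ 1

  -- Both sides are φ(1/((x+m)^(a+1) (x+n)^(b+1))).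
  E^-swap : ∀ a b m n φ → E^ (suc a) m φ (suc b) n ≈ E^ (suc b) n φ (suc a) m
  E^-swap a b m n φ = begin
    -- `1/(x+n)^(b+1)` is the constant 1 divided `b + 1` times by x+n. Both fractions thereby become
    -- powers of operators, which commute.
    E^ (suc a) m φ (suc b) n                 ≈⟨ E^-at-0 b n (E^ (suc a) m φ) n ⟨
    E^ (suc b) n (E^ (suc a) m φ) 0 n        ≈⟨ E^-comm (suc a) (suc b) m n φ 0 n ⟩
    E^ (suc a) m (E^ (suc b) n φ) 0 n        ≈⟨ E^-at-0 a m (E^ (suc b) n φ) n ⟩
    E^ (suc b) n φ (suc a) m                 ∎

  functional : (Letter → Carrier) → Functional
  functional φ zero    n         = 0#
  functional φ (suc k) (pos n p) = φ (y k n p)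

  ιs : List (ℚ × Letter) → List (Carrier × Letter)
  ιs = map (λ { (q , l) → (ι q , l) })

  pair-scale : ∀ q a φ → ⟪ ιs (map (λ { (r , l) → (q ℚ.* r , l) }) a) , φ ⟫ ≈ ι q * ⟪ ιs a , φ ⟫
  pair-scale q []            φ = sym (zeroʳ _)
  pair-scale q ((r , l) ∷ a) φ = trans (+-cong (*-congʳ (*-homo q r)) (pair-scale q a φ))
    (solve 4 (λ q r f t → q :* r :* f :+ q :* t := q :* (r :* f :+ t)) refl (ι q) (ι r) (φ l) ⟪ ιs a , φ ⟫)

  pair-singleton : ∀ l (φ : Letter → Carrier) → ⟪ ιs ((ℚ.1ℚ , l) ∷ []) , φ ⟫ ≈ φ l
  pair-singleton l φ = trans (+-identityʳ _) (trans (*-congʳ 1#-homo) (*-identityˡ _))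

  -- Both sides obey the same recursion in `a` and `b`: the last clause of `partialFraction` is one
  -- unfolding of `E`, with the same constant 1/(n - m).
  pair-partialFraction : ∀ m n .(p : Positive m) .(q : Positive n) → m ≢ n → ∀ φ a b →
    ⟪ ιs (partialFraction m n p q a b) , φ ⟫ ≈ E^ a (pos m p) (functional φ) b (pos n q)
  -- The value `0#` of `functional` at exponent 0 matches the empty list.
  pair-partialFraction m n p q m≢n φ zero    zero    = refl
  pair-partialFraction m n p q m≢n φ (suc a) zero    =
    trans (pair-singleton _ φ) (sym (E^-at-0 a (pos m p) (functional φ) (pos n q)))
  pair-partialFraction m n p q m≢n φ zero    (suc b) = pair-singleton _ φ
  pair-partialFraction m n p q m≢n φ (suc a) (suc b) = begin
    ⟪ ιs (partialFraction m n p q (suc a) (suc b)) , φ ⟫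
      ≈⟨ trans (reflexive (≡.cong ⟪_, φ ⟫ (map-++ _ (map _ (partialFraction m n p q (suc a) b)) _))) (pair-++ (ιs (map _ (partialFraction m n p q (suc a) b))) _ φ) ⟩
    ⟪ ιs (map _ (partialFraction m n p q (suc a) b)) , φ ⟫ + ⟪ ιs (map _ (partialFraction m n p q a (suc b))) , φ ⟫
      ≈⟨ +-cong (pair-scale d (partialFraction m n p q (suc a) b) φ) (pair-scale (ℚ.- d) (partialFraction m n p q a (suc b)) φ) ⟩
    ι d * ⟪ ιs (partialFraction m n p q (suc a) b) , φ ⟫ + ι (ℚ.- d) * ⟪ ιs (partialFraction m n p q a (suc b)) , φ ⟫
      ≈⟨ +-cong (*-congˡ (pair-partialFraction m n p q m≢n φ (suc a) b))
                (*-cong (-‿homo d) (pair-partialFraction m n p q m≢n φ a (suc b))) ⟩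
    ι d * F (suc a) b + - ι d * F a (suc b)
      ≈⟨ solve 3 (λ d s t → d :* s :+ :- d :* t := d :* (s :- t)) refl (ι d) (F (suc a) b) (F a (suc b)) ⟩
    ι d * (F (suc a) b - F a (suc b))
      ≈⟨ E-unfold ⟨
    F (suc a) (suc b) ∎
    where
    d : ℚ
    d = inv (n ℚ.- m)
    F : ℕ → ℕ → Carrier
    F a b = E^ a (pos m p) (functional φ) b (pos n q)
    E-unfold : F (suc a) (suc b) ≈ ι d * (F (suc a) b - F a (suc b))
    E-unfold with m ℚ.≟ n
    ... | yes m≡n = contradiction m≡n m≢n
    ... | no  _   = refl

  -- One formula covers both clauses of `⊙`, since at equal poles the operators merely raise the
  -- exponent. Commutativity and associativity of `⊙` thus become statements about powers of `E`.
  pair-⊙ : ∀ a b m n .(p : Positive m) .(q : Positive n) φ →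
    ⟪ ιs (y a m p ⊙ y b n q) , φ ⟫ ≈ E^ (suc a) (pos m p) (functional φ) (suc b) (pos n q)
  pair-⊙ a b m n p q φ = split (m ℚ.≟ n)
    where
    Goal : ℚ⁺ → Set ℓ
    Goal (pos n q) = ⟪ ιs (y a m p ⊙ y b n q) , φ ⟫ ≈ E^ (suc a) (pos m p) (functional φ) (suc b) (pos n q)
    split : Dec (m ≡ n) → Goal (pos n q)
    split (yes m≡n) = ≡.subst Goal (val-injective m≡n) (begin
      ⟪ ιs (y a m p ⊙ y b m p) , φ ⟫                     ≡⟨ ≡.cong (λ e → ⟪ ιs e , φ ⟫) (⊙-same a b m p) ⟩
      ⟪ ιs ((ℚ.1ℚ , y (suc (a ℕ.+ b)) m p) ∷ []) , φ ⟫   ≈⟨ pair-singleton _ φ ⟩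
      functional φ (suc (suc (a ℕ.+ b))) (pos m p)       ≡⟨ ≡.cong (λ j → functional φ (suc j) (pos m p)) (≡.trans (≡.cong suc (ℕₚ.+-comm a b)) (≡.sym (ℕₚ.+-suc b a))) ⟩
      functional φ (suc b ℕ.+ suc a) (pos m p)           ≈⟨ E^-same (suc a) (pos m p) (functional φ) (suc b) ⟨
      E^ (suc a) (pos m p) (functional φ) (suc b) (pos m p) ∎)
    split (no m≢n) = trans (reflexive (≡.cong (λ e → ⟪ ιs e , φ ⟫) (⊙-distinct a b m n p q m≢n)))
      (pair-partialFraction m n p q m≢n φ (suc a) (suc b))

  ⊙-comm : ∀ x z φ → ⟪ ιs (x ⊙ z) , φ ⟫ ≈ ⟪ ιs (z ⊙ x) , φ ⟫
  ⊙-comm (y a m p) (y b n q) φ = begin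
    ⟪ ιs (y a m p ⊙ y b n q) , φ ⟫                           ≈⟨ pair-⊙ a b m n p q φ ⟩
    E^ (suc a) (pos m p) (functional φ) (suc b) (pos n q)    ≈⟨ E^-swap a b (pos m p) (pos n q) (functional φ) ⟩
    E^ (suc b) (pos n q) (functional φ) (suc a) (pos m p)    ≈⟨ pair-⊙ b a n m q p φ ⟨
    ⟪ ιs (y b n q ⊙ y a m p) , φ ⟫                           ∎

  functional-⊙ : ∀ a m .(p : Positive m) φ k n →
    functional (λ l → ⟪ ιs (y a m p ⊙ l) , φ ⟫) (suc k) n ≈ E^ (suc a) (pos m p) (functional φ) (suc k) n
  functional-⊙ a m p φ k (pos n q) = pair-⊙ a k m n p q φ

  -- Multiplications by `x` and by `t` are commuting operators evaluated at `z`; `E^-swap` then lets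
  -- `z` act as an operator evaluated at `t`.
  ⊙-assoc : ∀ x z t φ → ⟪ ιs (x ⊙ z) , (λ l → ⟪ ιs (l ⊙ t) , φ ⟫) ⟫ ≈ ⟪ ιs (z ⊙ t) , (λ l → ⟪ ιs (x ⊙ l) , φ ⟫) ⟫
  ⊙-assoc x@(y a m p) z@(y b n q) t@(y d o r) φ = begin
    ⟪ ιs (x ⊙ z) , (λ l → ⟪ ιs (l ⊙ t) , φ ⟫) ⟫        ≈⟨ pair-cong (ιs (x ⊙ z)) (λ l → ⊙-comm l t φ) ⟩
    ⟪ ιs (x ⊙ z) , (λ l → ⟪ ιs (t ⊙ l) , φ ⟫) ⟫        ≈⟨ pair-⊙ a b m n p q _ ⟩
    E^ (suc a) M (functional (λ l → ⟪ ιs (t ⊙ l) , φ ⟫)) (suc b) N ≈⟨ E^-cong (suc a) M (functional-⊙ d o r φ) b N ⟩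
    E^ (suc a) M (E^ (suc d) O Φ) (suc b) N            ≈⟨ E^-comm (suc d) (suc a) O M Φ (suc b) N ⟩
    E^ (suc d) O (E^ (suc a) M Φ) (suc b) N            ≈⟨ E^-swap d b O N (E^ (suc a) M Φ) ⟩
    E^ (suc b) N (E^ (suc a) M Φ) (suc d) O            ≈⟨ E^-cong (suc b) N (functional-⊙ a m p φ) d O ⟨
    E^ (suc b) N (functional (λ l → ⟪ ιs (x ⊙ l) , φ ⟫)) (suc d) O ≈⟨ pair-⊙ b d n o q r _ ⟨
    ⟪ ιs (z ⊙ t) , (λ l → ⟪ ιs (x ⊙ l) , φ ⟫) ⟫        ∎
    where
    M N O : ℚ⁺
    M = pos m p
    N = pos n q
    O = pos o r
    Φ : Functional
    Φ = functional φ

  -- This is `r` times the residue at x = -n of the fraction that the letter stands for. The factor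
  -- `r` will be the value of a functional on the rest of a word.
  residue : Carrier → Letter → Carrier
  residue r (y zero    n p) = r
  residue r (y (suc k) n p) = 0#

  E-0 : ∀ m {φ} → (∀ k n → φ (suc k) n ≈ 0#) → ∀ k n → E m φ k n ≈ 0#
  E-0 m eq k n = trans (E-cong m {χ = λ _ _ → 0#} eq k n) (E-const k n)
    where
    E-const : ∀ k n → E m (λ _ _ → 0#) k n ≈ 0#
    E-const zero    n = refl
    E-const (suc k) n with val m ℚ.≟ val n
    ... | yes _ = refl
    ... | no  _ = trans (*-congˡ (trans (+-congʳ (E-const k n)) (-‿inverseʳ 0#))) (zeroʳ _)

  -- A single division by x+m already makes `1/(x+n)^(k+1)` decay quadratically. At distinct poles
  -- the recursion starts from the two simple fractions, whose residues `r` cancel; at equal poles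
  -- the exponent is at least 2.
  E-residue : ∀ m r k n → E m (functional (residue r)) (suc k) n ≈ 0#
  E-residue m r k n = split (val m ℚ.≟ val n) k
    where
    Φ : Functional
    Φ = functional (residue r)
    split : Dec (val m ≡ val n) → ∀ k → E m Φ (suc k) n ≈ 0#
    split (yes m≡n) k with ≡.refl ← val-injective {m} {n} m≡n = E-same m Φ (suc k)
    split (no m≢n) zero    = difference-cancel m≢n
      (trans (E-distinct m n Φ 0 m≢n) (trans (-‿inverseʳ r) (sym (zeroʳ _))))
    split (no m≢n) (suc k) = difference-cancel m≢n
      (trans (E-distinct m n Φ (suc k) m≢n)
        (trans (+-congʳ (split (no m≢n) k)) (trans (-‿inverseʳ 0#) (sym (zeroʳ _)))))

  -- The sum of the residues of 1/((x+m)^a (x+n)^b) vanishes.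
  ⊙-residue : ∀ x z r → ⟪ ιs (x ⊙ z) , residue r ⟫ ≈ 0#
  ⊙-residue (y a m p) (y b n q) r = begin
    ⟪ ιs (y a m p ⊙ y b n q) , residue r ⟫ ≈⟨ pair-⊙ a b m n p q (residue r) ⟩
    -- One division is moved next to the residue functional, where `E-residue` kills it.
    E^ (suc a) M Φ (suc b) N  ≈⟨ E-E^-comm a M M Φ (suc b) N ⟩
    E^ a M (E M Φ) (suc b) N  ≈⟨ E^-cong a M {χ = λ _ _ → 0#} (E-residue M r) b N ⟩
    E^ a M (λ _ _ → 0#) (suc b) N ≈⟨ E^-0 a b N ⟩
    0# ∎
    where
    M N : ℚ⁺
    M = pos m p
    N = pos n q
    Φ : Functional
    Φ = functional (residue r)
    E^-0 : ∀ a k n → E^ a M (λ _ _ → 0#) (suc k) n ≈ 0#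
    E^-0 zero    k n = refl
    E^-0 (suc a) k n = E-0 M (E^-0 a) (suc k) n

  -- Commutativity and associativity of the stuffle product

  private
    reversed : Elt → Elt
    reversed = map (λ { (r , w) → (r , reverse w) })

    pair-reversed : ∀ a φ → ⟪ reversed a , (λ w → φ (reverse w)) ⟫ ≈ ⟪ a , φ ⟫
    pair-reversed a φ = pair-map _ φ (λ r w → *-congˡ (reflexive (≡.cong φ (reverse-involutive w)))) a

    -- The omitted body, found by unification, is the recursive function
    -- stuffleRev, which Defs keeps private.
    mutual
      stuffleʳ : Word → Word → Elt
      stuffleʳ u v = _

      stuffleWord≡ : ∀ u v → stuffleWord u v ≡ reversed (stuffleʳ u v)
      stuffleWord≡ u v = ≡.refl

    stuffleʳ-∷ : ∀ x u z v → stuffleʳ (reverse (x ∷ u)) (reverse (z ∷ v)) ≡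
      map (λ { (r , w) → (r , x ∷ w) }) (stuffleʳ (reverse u) (reverse (z ∷ v))) ++
      map (λ { (r , w) → (r , z ∷ w) }) (stuffleʳ (reverse (x ∷ u)) (reverse v)) ++
      concatMap (λ { (r , w) → map (λ { (q , l) → ((- μ) * (r * ι q) , l ∷ w) }) (x ⊙ z) })
                (stuffleʳ (reverse u) (reverse v))
    stuffleʳ-∷ x u z v
      rewrite reverse-involutive (x ∷ u) | reverse-involutive (z ∷ v) | reverse-involutive u | reverse-involutive v = ≡.refl

  -- After this block `S` is known only by its recursion, its linearity and its link to
  -- `stuffleWord`; keeping it opaque prevents the products from unfolding in the inductions below.
  abstract
    -- The μ-stuffle product of two reversed words, paired with a functional of
    -- the reversed words occurring in it.
    S : Word → Word → (Word → Carrier) → Carrier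
    S u v φ = ⟪ stuffleWord (reverse u) (reverse v) , (λ w → φ (reverse w)) ⟫

    S-[]ˡ : ∀ v φ → S [] v φ ≈ φ v
    S-[]ˡ v φ = trans (pair-single (reverse (reverse (reverse v))) (λ w → φ (reverse w)))
      (reflexive (≡.cong φ (≡.trans (reverse-involutive _) (reverse-involutive v))))

    S-[]ʳ : ∀ u φ → S u [] φ ≈ φ u
    S-[]ʳ []      φ = pair-single [] φ
    S-[]ʳ (x ∷ u) φ rewrite reverse-involutive (x ∷ u) =
      trans (pair-single (reverse (x ∷ u)) (λ w → φ (reverse w))) (reflexive (≡.cong φ (reverse-involutive (x ∷ u))))

    S-∷ : ∀ x u z v φ → S (x ∷ u) (z ∷ v) φ ≈
          S u (z ∷ v) (λ w → φ (x ∷ w)) + (S (x ∷ u) v (λ w → φ (z ∷ w)) +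
          - μ * S u v (λ w → ⟪ ιs (x ⊙ z) , (λ l → φ (l ∷ w)) ⟫))
    S-∷ x u z v φ = trans (reflexive (≡.cong (λ a → ⟪ reversed a , (λ w → φ (reverse w)) ⟫) (stuffleʳ-∷ x u z v)))
      (step (stuffleʳ (reverse u) (reverse (z ∷ v))) (stuffleʳ (reverse (x ∷ u)) (reverse v)) (stuffleʳ (reverse u) (reverse v)))
      where
      step : ∀ a b e →
        ⟪ reversed (map (λ { (r , w) → (r , x ∷ w) }) a ++ map (λ { (r , w) → (r , z ∷ w) }) b ++
            concatMap (λ { (r , w) → map (λ { (q , l) → ((- μ) * (r * ι q) , l ∷ w) }) (x ⊙ z) }) e) , (λ w → φ (reverse w)) ⟫ ≈
        ⟪ reversed a , (λ w → φ (x ∷ reverse w)) ⟫ + (⟪ reversed b , (λ w → φ (z ∷ reverse w)) ⟫ +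
        - μ * ⟪ reversed e , (λ w → ⟪ ιs (x ⊙ z) , (λ l → φ (l ∷ reverse w)) ⟫) ⟫)
      step a b e = trans (pair-reversed (map _ a ++ map _ b ++ concatMap _ e) φ) (trans (pair-++ (map _ a) _ φ) (+-cong
        (trans (pair-map _ (λ w → φ (x ∷ w)) (λ _ _ → refl) a) (sym (pair-reversed a _)))
        (trans (pair-++ (map _ b) _ φ) (+-cong
          (trans (pair-map _ (λ w → φ (z ∷ w)) (λ _ _ → refl) b) (sym (pair-reversed b _)))
          (trans (pair-concatMap _ (λ w → - μ * ⟪ ιs (x ⊙ z) , (λ l → φ (l ∷ w)) ⟫) (λ r w → contract r w (x ⊙ z)) e)
            (trans (pair-* e (- μ) _) (*-congˡ (sym (pair-reversed e _)))))))))
        where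
        contract : ∀ r w ls → ⟪ map (λ { (q , l) → ((- μ) * (r * ι q) , l ∷ w) }) ls , φ ⟫ ≈
                   r * (- μ * ⟪ ιs ls , (λ l → φ (l ∷ w)) ⟫)
        contract r w []             = sym (trans (*-congˡ (zeroʳ _)) (zeroʳ r))
        contract r w ((q , l) ∷ ls) = trans (+-congˡ (contract r w ls))
          (solve 5 (λ k r q f t → k :* (r :* q) :* f :+ r :* (k :* t) := r :* (k :* (q :* f :+ t))) refl
            (- μ) r (ι q) (φ (l ∷ w)) ⟪ ιs ls , (λ l → φ (l ∷ w)) ⟫)

    S-cong : ∀ u v {φ χ} → (∀ w → φ w ≈ χ w) → S u v φ ≈ S u v χ
    S-cong u v eq = pair-cong (stuffleWord (reverse u) (reverse v)) (λ w → eq (reverse w))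

    S-+ : ∀ u v φ χ → S u v (λ w → φ w + χ w) ≈ S u v φ + S u v χ
    S-+ u v φ χ = pair-+ (stuffleWord (reverse u) (reverse v)) _ _

    S-* : ∀ u v r φ → S u v (λ w → r * φ w) ≈ r * S u v φ
    S-* u v r φ = pair-* (stuffleWord (reverse u) (reverse v)) r _

    pair-S : {A : Set} (a : List (Carrier × A)) → ∀ u v (φ : A → Word → Carrier) →
             ⟪ a , (λ l → S u v (φ l)) ⟫ ≈ S u v (λ w → ⟪ a , (λ l → φ l w) ⟫)
    pair-S a u v φ = pair-swap a (stuffleWord (reverse u) (reverse v)) _

    pair-stuffleWord : ∀ u v φ → ⟪ stuffleWord u v , φ ⟫ ≈ S (reverse u) (reverse v) (λ w → φ (reverse w))
    pair-stuffleWord u v φ = trans (reflexive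
      (≡.cong₂ (λ u v → ⟪ stuffleWord u v , φ ⟫) (≡.sym (reverse-involutive u)) (≡.sym (reverse-involutive v))))
      (pair-cong (stuffleWord (reverse (reverse u)) (reverse (reverse v))) (λ w → reflexive (≡.cong φ (≡.sym (reverse-involutive w)))))

  S-comm : ∀ u v φ → S u v φ ≈ S v u φ
  S-comm []      v       φ = trans (S-[]ˡ v φ) (sym (S-[]ʳ v φ))
  S-comm (x ∷ u) []      φ = trans (S-[]ʳ (x ∷ u) φ) (sym (S-[]ˡ (x ∷ u) φ))
  S-comm (x ∷ u) (z ∷ v) φ = begin
    S (x ∷ u) (z ∷ v) φ
      ≈⟨ S-∷ x u z v φ ⟩
    S u (z ∷ v) (λ w → φ (x ∷ w)) + (S (x ∷ u) v (λ w → φ (z ∷ w)) +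
      - μ * S u v (λ w → ⟪ ιs (x ⊙ z) , (λ l → φ (l ∷ w)) ⟫))
      ≈⟨ +-cong (S-comm u (z ∷ v) _) (+-cong (S-comm (x ∷ u) v _)
           (*-congˡ (trans (S-comm u v _) (S-cong v u (λ w → ⊙-comm x z _))))) ⟩
    S (z ∷ v) u (λ w → φ (x ∷ w)) + (S v (x ∷ u) (λ w → φ (z ∷ w)) +
      - μ * S v u (λ w → ⟪ ιs (z ⊙ x) , (λ l → φ (l ∷ w)) ⟫))
      ≈⟨ solve 3 (λ a b d → a :+ (b :+ d) := b :+ (a :+ d)) refl _ _ _ ⟩
    S v (x ∷ u) (λ w → φ (z ∷ w)) + (S (z ∷ v) u (λ w → φ (x ∷ w)) +
      - μ * S v u (λ w → ⟪ ιs (z ⊙ x) , (λ l → φ (l ∷ w)) ⟫))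
      ≈⟨ S-∷ z v x u φ ⟨
    S (z ∷ v) (x ∷ u) φ ∎

  S₃ : Word → Word → Word → (Word → Carrier) → Carrier
  S₃ u v t φ = S u v (λ w → S w t φ)

  -- There is one term for each nonempty subset of the three letters `x`, `z`, `s`. Its letters
  -- merge into the last letter of the product, and a subset of size j has the coefficient
  -- (-μ)^(j-1).
  S₃-∷ : ∀ x u z v s t φ → S₃ (x ∷ u) (z ∷ v) (s ∷ t) φ ≈
    S₃ u (z ∷ v) (s ∷ t) (λ w → φ (x ∷ w)) + S₃ (x ∷ u) v (s ∷ t) (λ w → φ (z ∷ w)) +
    S₃ (x ∷ u) (z ∷ v) t (λ w → φ (s ∷ w)) +
    - μ * (S₃ u (z ∷ v) t (λ w → ⟪ ιs (x ⊙ s) , (λ l → φ (l ∷ w)) ⟫) +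
           S₃ (x ∷ u) v t (λ w → ⟪ ιs (z ⊙ s) , (λ l → φ (l ∷ w)) ⟫) +
           S₃ u v (s ∷ t) (λ w → ⟪ ιs (x ⊙ z) , (λ l → φ (l ∷ w)) ⟫)) +
    - μ * (- μ * S₃ u v t (λ w → ⟪ ιs (x ⊙ z) , (λ l → ⟪ ιs (l ⊙ s) , (λ k → φ (k ∷ w)) ⟫) ⟫))
  S₃-∷ x u z v s t φ = begin
    S (x ∷ u) (z ∷ v) g
      -- `h` collects the part of `g` where `s` alone comes last. Splitting it off first keeps that
      -- part as one triple product, instead of scattering it over the three terms of `S-∷`.
      ≈⟨ S-cong (x ∷ u) (z ∷ v) (λ w → solve 2 (λ a b → a := a :- b :+ b) refl (g w) (h w)) ⟩
    S (x ∷ u) (z ∷ v) (λ w → g w - h w + h w)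
      ≈⟨ S-+ (x ∷ u) (z ∷ v) _ h ⟩
    S (x ∷ u) (z ∷ v) (λ w → g w - h w) + H
      ≈⟨ +-congʳ (S-∷ x u z v _) ⟩
    S u (z ∷ v) (λ w → g (x ∷ w) - h (x ∷ w)) + (S (x ∷ u) v (λ w → g (z ∷ w) - h (z ∷ w)) +
      - μ * S u v (λ w → ⟪ ιs (x ⊙ z) , (λ l → g (l ∷ w) - h (l ∷ w)) ⟫)) + H
      ≈⟨ +-congʳ (+-cong (expand u (z ∷ v) x) (+-cong (expand (x ∷ u) v z) (*-congˡ contract))) ⟩
    (a₁ + - μ * a₂) + ((b₁ + - μ * b₂) + - μ * (d₁ + - μ * d₂)) + H
      ≈⟨ solve 8 (λ a₁ a₂ b₁ b₂ d₁ d₂ H k →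
           (a₁ :+ k :* a₂) :+ ((b₁ :+ k :* b₂) :+ k :* (d₁ :+ k :* d₂)) :+ H :=
           a₁ :+ b₁ :+ H :+ k :* (a₂ :+ b₂ :+ d₁) :+ k :* (k :* d₂)) refl a₁ a₂ b₁ b₂ d₁ d₂ H (- μ) ⟩
    a₁ + b₁ + H + - μ * (a₂ + b₂ + d₁) + - μ * (- μ * d₂) ∎
    where
    g h : Word → Carrier
    g w = S w (s ∷ t) φ
    h w = S w t (λ w → φ (s ∷ w))

    φ⊙ : Letter → Word → Carrier
    φ⊙ l w = ⟪ ιs (l ⊙ s) , (λ k → φ (k ∷ w)) ⟫

    a₁ = S₃ u (z ∷ v) (s ∷ t) (λ w → φ (x ∷ w))
    a₂ = S₃ u (z ∷ v) t (φ⊙ x)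
    b₁ = S₃ (x ∷ u) v (s ∷ t) (λ w → φ (z ∷ w))
    b₂ = S₃ (x ∷ u) v t (φ⊙ z)
    d₁ = S₃ u v (s ∷ t) (λ w → ⟪ ιs (x ⊙ z) , (λ l → φ (l ∷ w)) ⟫)
    d₂ = S₃ u v t (λ w → ⟪ ιs (x ⊙ z) , (λ l → φ⊙ l w) ⟫)
    H  = S₃ (x ∷ u) (z ∷ v) t (λ w → φ (s ∷ w))

    g-h : ∀ l w → g (l ∷ w) - h (l ∷ w) ≈ S w (s ∷ t) (λ w → φ (l ∷ w)) + - μ * S w t (φ⊙ l)
    g-h l w = trans (+-congʳ (S-∷ l w s t φ))
      (solve 3 (λ a b d → a :+ (b :+ d) :- b := a :+ d) refl (S w (s ∷ t) (λ w → φ (l ∷ w))) (h (l ∷ w)) _)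

    expand : ∀ u v l → S u v (λ w → g (l ∷ w) - h (l ∷ w)) ≈
             S₃ u v (s ∷ t) (λ w → φ (l ∷ w)) + - μ * S₃ u v t (φ⊙ l)
    expand u v l = trans (S-cong u v (g-h l)) (trans (S-+ u v _ _) (+-congˡ (S-* u v (- μ) _)))

    contract : S u v (λ w → ⟪ ιs (x ⊙ z) , (λ l → g (l ∷ w) - h (l ∷ w)) ⟫) ≈ d₁ + - μ * d₂
    contract = begin
      S u v (λ w → ⟪ ιs (x ⊙ z) , (λ l → g (l ∷ w) - h (l ∷ w)) ⟫)
        ≈⟨ S-cong u v (λ w → trans (pair-cong (ιs (x ⊙ z)) (λ l → g-h l w))
             (trans (pair-+ (ιs (x ⊙ z)) _ _) (+-cong (pair-S (ιs (x ⊙ z)) w (s ∷ t) _)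
               (trans (pair-* (ιs (x ⊙ z)) (- μ) _) (*-congˡ (pair-S (ιs (x ⊙ z)) w t φ⊙)))))) ⟩
      S u v (λ w → S w (s ∷ t) (λ w → ⟪ ιs (x ⊙ z) , (λ l → φ (l ∷ w)) ⟫) +
        - μ * S w t (λ w → ⟪ ιs (x ⊙ z) , (λ l → φ⊙ l w) ⟫))
        ≈⟨ trans (S-+ u v _ _) (+-congˡ (S-* u v (- μ) _)) ⟩
      d₁ + - μ * d₂ ∎

  -- Reversing the factors permutes the seven terms of `S₃-∷`, so an expansion of left-bracketed
  -- products alone serves both sides. Associativity is then (u ∗ v) ∗ t = (t ∗ v) ∗ u = u ∗ (v ∗
  -- t), by commutativity.
  S₃-flip : ∀ u v t φ → S₃ u v t φ ≈ S₃ t v u φ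
  S₃-flip [] v t φ = trans (S-[]ˡ v _) (trans (S-comm v t φ) (S-cong t v (λ w → sym (S-[]ʳ w φ))))
  S₃-flip (x ∷ u) [] t φ = trans (S-[]ʳ (x ∷ u) _) (trans (S-comm (x ∷ u) t φ) (sym (S-[]ʳ t _)))
  S₃-flip (x ∷ u) (z ∷ v) [] φ =
    trans (S-cong (x ∷ u) (z ∷ v) (λ w → S-[]ʳ w φ)) (trans (S-comm (x ∷ u) (z ∷ v) φ) (sym (S-[]ˡ (z ∷ v) _)))
  S₃-flip (x ∷ u) (z ∷ v) (s ∷ t) φ = begin
    S₃ (x ∷ u) (z ∷ v) (s ∷ t) φ
      ≈⟨ S₃-∷ x u z v s t φ ⟩
    _
      ≈⟨ +-cong (+-cong
           (+-cong (+-cong (S₃-flip u (z ∷ v) (s ∷ t) _) (S₃-flip (x ∷ u) v (s ∷ t) _)) (S₃-flip (x ∷ u) (z ∷ v) t _))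
           (*-congˡ (+-cong (+-cong
             (trans (S₃-flip u (z ∷ v) t _) (S₃-cong t (z ∷ v) u (λ w → ⊙-comm x s _)))
             (trans (S₃-flip (x ∷ u) v t _) (S₃-cong t v (x ∷ u) (λ w → ⊙-comm z s _))))
             (trans (S₃-flip u v (s ∷ t) _) (S₃-cong (s ∷ t) v u (λ w → ⊙-comm x z _))))))
           (*-congˡ (*-congˡ (trans (S₃-flip u v t _) (S₃-cong t v u (λ w → ⊙-flip (λ k → φ (k ∷ w))))))) ⟩
    _
      ≈⟨ solve 8 (λ a₁ b₁ H a₂ b₂ d₁ d₂ k →
           a₁ :+ b₁ :+ H :+ k :* (a₂ :+ b₂ :+ d₁) :+ k :* (k :* d₂) :=
           H :+ b₁ :+ a₁ :+ k :* (a₂ :+ d₁ :+ b₂) :+ k :* (k :* d₂)) refl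
           (S₃ (s ∷ t) (z ∷ v) u (λ w → φ (x ∷ w))) (S₃ (s ∷ t) v (x ∷ u) (λ w → φ (z ∷ w)))
           (S₃ t (z ∷ v) (x ∷ u) (λ w → φ (s ∷ w))) (S₃ t (z ∷ v) u _) (S₃ t v (x ∷ u) _) (S₃ (s ∷ t) v u _) (S₃ t v u _) (- μ) ⟩
    _
      ≈⟨ S₃-∷ s t z v x u φ ⟨
    S₃ (s ∷ t) (z ∷ v) (x ∷ u) φ ∎
    where
    S₃-cong : ∀ u v t {φ χ} → (∀ w → φ w ≈ χ w) → S₃ u v t φ ≈ S₃ u v t χ
    S₃-cong u v t eq = S-cong u v (λ w → S-cong w t eq)

    ⊙-flip : ∀ φ → ⟪ ιs (x ⊙ z) , (λ l → ⟪ ιs (l ⊙ s) , φ ⟫) ⟫ ≈ ⟪ ιs (s ⊙ z) , (λ l → ⟪ ιs (l ⊙ x) , φ ⟫) ⟫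
    ⊙-flip φ = trans (⊙-assoc x z s φ)
      (trans (⊙-comm z s _) (pair-cong (ιs (s ⊙ z)) (λ l → ⊙-comm x l φ)))

  S-assoc : ∀ u v t φ → S u v (λ w → S w t φ) ≈ S v t (λ w → S u w φ)
  S-assoc u v t φ = trans (S₃-flip u v t φ) (trans (S-comm t v _) (S-cong v t (λ w → S-comm w u φ)))

  stuffleWord-comm : ∀ u v φ → ⟪ stuffleWord u v , φ ⟫ ≈ ⟪ stuffleWord v u , φ ⟫
  stuffleWord-comm u v φ =
    trans (pair-stuffleWord u v φ) (trans (S-comm (reverse u) (reverse v) _) (sym (pair-stuffleWord v u φ)))

  stuffleWord-assoc : ∀ u v t φ →
    ⟪ stuffleWord u v , (λ w → ⟪ stuffleWord w t , φ ⟫) ⟫ ≈ ⟪ stuffleWord v t , (λ w → ⟪ stuffleWord u w , φ ⟫) ⟫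
  stuffleWord-assoc u v t φ = begin
    ⟪ stuffleWord u v , (λ w → ⟪ stuffleWord w t , φ ⟫) ⟫    ≈⟨ pair-stuffleWord u v _ ⟩
    S (reverse u) (reverse v) (λ w → ⟪ stuffleWord (reverse w) t , φ ⟫)
      ≈⟨ S-cong _ _ (λ w → trans (pair-stuffleWord (reverse w) t φ) (reflexive (≡.cong (λ w → S w _ _) (reverse-involutive w)))) ⟩
    S (reverse u) (reverse v) (λ w → S w (reverse t) φʳ)     ≈⟨ S-assoc (reverse u) (reverse v) (reverse t) φʳ ⟩
    S (reverse v) (reverse t) (λ w → S (reverse u) w φʳ)
      ≈⟨ S-cong _ _ (λ w → trans (pair-stuffleWord u (reverse w) φ) (reflexive (≡.cong (λ w → S _ w _) (reverse-involutive w)))) ⟨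
    S (reverse v) (reverse t) (λ w → ⟪ stuffleWord u (reverse w) , φ ⟫) ≈⟨ pair-stuffleWord v t _ ⟨
    ⟪ stuffleWord v t , (λ w → ⟪ stuffleWord u w , φ ⟫) ⟫    ∎
    where
    φʳ : Word → Carrier
    φʳ w = φ (reverse w)

  stuffleWord-[] : ∀ v φ → ⟪ stuffleWord [] v , φ ⟫ ≈ φ v
  stuffleWord-[] v φ = trans (pair-stuffleWord [] v φ)
    (trans (S-[]ˡ (reverse v) _) (reflexive (≡.cong φ (reverse-involutive v))))

  pair-∗ : ∀ a b φ → ⟪ a ∗ b , φ ⟫ ≈ ⟪ a , (λ u → ⟪ b , (λ v → ⟪ stuffleWord u v , φ ⟫) ⟫) ⟫
  pair-∗ a b φ = pair-concatMap _ _ (λ r u → trans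
    (pair-concatMap _ (λ v → r * ⟪ stuffleWord u v , φ ⟫)
      (λ s v → trans (pair-· (r * s) (stuffleWord u v) φ)
        (solve 3 (λ r s t → r :* s :* t := s :* (r :* t)) refl r s ⟪ stuffleWord u v , φ ⟫)) b)
    (pair-* b r _)) a

  ∗-cong : ∀ {a a′ b b′} → a ≃ a′ → b ≃ b′ → a ∗ b ≃ a′ ∗ b′
  ∗-cong {a} {a′} {b} {b′} a≃a′ b≃b′ .at φ = begin
    ⟪ a ∗ b , φ ⟫                                             ≈⟨ pair-∗ a b φ ⟩
    ⟪ a , (λ u → ⟪ b , (λ v → ⟪ stuffleWord u v , φ ⟫) ⟫) ⟫   ≈⟨ at a≃a′ _ ⟩
    ⟪ a′ , (λ u → ⟪ b , (λ v → ⟪ stuffleWord u v , φ ⟫) ⟫) ⟫  ≈⟨ pair-cong a′ (λ u → at b≃b′ _) ⟩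
    ⟪ a′ , (λ u → ⟪ b′ , (λ v → ⟪ stuffleWord u v , φ ⟫) ⟫) ⟫ ≈⟨ pair-∗ a′ b′ φ ⟨
    ⟪ a′ ∗ b′ , φ ⟫                                           ∎

  ∗-comm : ∀ a b → a ∗ b ≃ b ∗ a
  ∗-comm a b .at φ = begin
    ⟪ a ∗ b , φ ⟫                                             ≈⟨ pair-∗ a b φ ⟩
    ⟪ a , (λ u → ⟪ b , (λ v → ⟪ stuffleWord u v , φ ⟫) ⟫) ⟫   ≈⟨ pair-swap a b _ ⟩
    ⟪ b , (λ v → ⟪ a , (λ u → ⟪ stuffleWord u v , φ ⟫) ⟫) ⟫   ≈⟨ pair-cong b (λ v → pair-cong a (λ u → stuffleWord-comm u v φ)) ⟩
    ⟪ b , (λ v → ⟪ a , (λ u → ⟪ stuffleWord v u , φ ⟫) ⟫) ⟫   ≈⟨ pair-∗ b a φ ⟨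
    ⟪ b ∗ a , φ ⟫                                             ∎

  ∗-assoc : ∀ a b d → (a ∗ b) ∗ d ≃ a ∗ (b ∗ d)
  ∗-assoc a b d .at φ = begin
    ⟪ (a ∗ b) ∗ d , φ ⟫
      ≈⟨ trans (pair-∗ (a ∗ b) d φ) (pair-∗ a b _) ⟩
    ⟪ a , (λ u → ⟪ b , (λ v → ⟪ stuffleWord u v , (λ w → ⟪ d , (λ t → ⟪ stuffleWord w t , φ ⟫) ⟫) ⟫) ⟫) ⟫
      ≈⟨ pair-cong a (λ u → pair-cong b (λ v → trans (pair-swap (stuffleWord u v) d _)
           (pair-cong d (λ t → stuffleWord-assoc u v t φ)))) ⟩
    ⟪ a , (λ u → ⟪ b , (λ v → ⟪ d , (λ t → ⟪ stuffleWord v t , (λ w → ⟪ stuffleWord u w , φ ⟫) ⟫) ⟫) ⟫) ⟫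
      ≈⟨ trans (pair-∗ a (b ∗ d) φ) (pair-cong a (λ u → pair-∗ b d _)) ⟨
    ⟪ a ∗ (b ∗ d) , φ ⟫ ∎

  ∗-identityˡ : ∀ a → oneE ∗ a ≃ a
  ∗-identityˡ a .at φ = trans (pair-∗ oneE a φ) (trans (pair-single [] (λ u → ⟪ a , (λ v → ⟪ stuffleWord u v , φ ⟫) ⟫)) (pair-cong a (λ v → stuffleWord-[] v φ)))

  ∗-distribʳ : ∀ a b d → (b ⊕ d) ∗ a ≃ (b ∗ a) ⊕ (d ∗ a)
  ∗-distribʳ a b d .at φ = begin
    ⟪ (b ⊕ d) ∗ a , φ ⟫            ≈⟨ trans (pair-∗ (b ⊕ d) a φ) (pair-++ b d _) ⟩
    _                              ≈⟨ +-cong (pair-∗ b a φ) (pair-∗ d a φ) ⟨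
    ⟪ b ∗ a , φ ⟫ + ⟪ d ∗ a , φ ⟫  ≈⟨ pair-++ (b ∗ a) (d ∗ a) φ ⟨
    ⟪ (b ∗ a) ⊕ (d ∗ a) , φ ⟫      ∎

  ⊕-cong : ∀ {a a′ b b′} → a ≃ a′ → b ≃ b′ → a ⊕ b ≃ a′ ⊕ b′
  ⊕-cong {a} {a′} {b} {b′} a≃a′ b≃b′ .at φ =
    trans (pair-++ a b φ) (trans (+-cong (at a≃a′ φ) (at b≃b′ φ)) (sym (pair-++ a′ b′ φ)))

  ⊕-comm : ∀ a b → a ⊕ b ≃ b ⊕ a
  ⊕-comm a b .at φ = trans (pair-++ a b φ) (trans (+-comm _ _) (sym (pair-++ b a φ)))

  -- The semiring structure is what the solver for the Horner identities consumes; subtraction comes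
  -- from the scalar -1, through `minus`.
  stuffleAlgebra : CommutativeSemiring c (c ⊔ ℓ)
  stuffleAlgebra = record
    { Carrier = Elt
    ; _≈_ = _≃_
    ; _+_ = _⊕_
    ; _*_ = _∗_
    ; 0# = zeroE
    ; 1# = oneE
    ; isCommutativeSemiring = Biased.isCommutativeSemiringˡ record
      { +-isCommutativeMonoid = Biased.isCommutativeMonoidˡ record
        { isSemigroup = record
          { isMagma = record { isEquivalence = ≃-isEquivalence ; ∙-cong = ⊕-cong }
          ; assoc = λ a b d → mk≃ (λ φ → reflexive (≡.cong ⟪_, φ ⟫ (++-assoc a b d))) }
        ; identityˡ = λ a → mk≃ (λ φ → refl)
        ; comm = ⊕-comm }
      ; *-isCommutativeMonoid = Biased.isCommutativeMonoidˡ record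
        { isSemigroup = record
          { isMagma = record { isEquivalence = ≃-isEquivalence ; ∙-cong = ∗-cong }
          ; assoc = ∗-assoc }
        ; identityˡ = ∗-identityˡ
        ; comm = ∗-comm }
      ; distribʳ = ∗-distribʳ
      ; zeroˡ = λ a → mk≃ (λ φ → refl)
      } }
    where
    ≃-isEquivalence : IsEquivalence _≃_
    ≃-isEquivalence = record
      { refl  = mk≃ (λ φ → refl)
      ; sym   = λ a≃b → mk≃ (λ φ → sym (at a≃b φ))
      ; trans = λ a≃b b≃d → mk≃ (λ φ → trans (at a≃b φ) (at b≃d φ)) }

  ·-cong : ∀ r {a b} → a ≃ b → r · a ≃ r · b
  ·-cong r {a} {b} a≃b .at φ = trans (pair-· r a φ) (trans (*-congˡ (at a≃b φ)) (sym (pair-· r b φ)))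

  ·-⊕ : ∀ r a b → r · (a ⊕ b) ≃ (r · a) ⊕ (r · b)
  ·-⊕ r a b .at φ = begin
    ⟪ r · (a ⊕ b) , φ ⟫             ≈⟨ trans (pair-· r (a ⊕ b) φ) (*-congˡ (pair-++ a b φ)) ⟩
    r * (⟪ a , φ ⟫ + ⟪ b , φ ⟫)     ≈⟨ distribˡ r _ _ ⟩
    r * ⟪ a , φ ⟫ + r * ⟪ b , φ ⟫   ≈⟨ +-cong (pair-· r a φ) (pair-· r b φ) ⟨
    ⟪ r · a , φ ⟫ + ⟪ r · b , φ ⟫   ≈⟨ pair-++ (r · a) (r · b) φ ⟨
    ⟪ (r · a) ⊕ (r · b) , φ ⟫       ∎

  ·-inverse : ∀ r s a → r * s ≈ 1# → r · (s · a) ≃ a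
  ·-inverse r s a rs≈1 .at φ = begin
    ⟪ r · (s · a) , φ ⟫  ≈⟨ trans (pair-· r (s · a) φ) (*-congˡ (pair-· s a φ)) ⟩
    r * (s * ⟪ a , φ ⟫)  ≈⟨ *-assoc r s _ ⟨
    r * s * ⟪ a , φ ⟫    ≈⟨ trans (*-congʳ rs≈1) (*-identityˡ _) ⟩
    ⟪ a , φ ⟫            ∎

  ∗-· : ∀ r a b → a ∗ (r · b) ≃ r · (a ∗ b)
  ∗-· r a b .at φ = begin
    ⟪ a ∗ (r · b) , φ ⟫  ≈⟨ pair-∗ a (r · b) φ ⟩
    ⟪ a , (λ u → ⟪ r · b , (λ v → ⟪ stuffleWord u v , φ ⟫) ⟫) ⟫    ≈⟨ pair-cong a (λ u → pair-· r b _) ⟩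
    ⟪ a , (λ u → r * ⟪ b , (λ v → ⟪ stuffleWord u v , φ ⟫) ⟫) ⟫    ≈⟨ pair-* a r _ ⟩
    r * ⟪ a , (λ u → ⟪ b , (λ v → ⟪ stuffleWord u v , φ ⟫) ⟫) ⟫    ≈⟨ *-congˡ (pair-∗ a b φ) ⟨
    r * ⟪ a ∗ b , φ ⟫    ≈⟨ pair-· r (a ∗ b) φ ⟨
    ⟪ r · (a ∗ b) , φ ⟫  ∎

  -- The derivation π

  -- The transpose of π on functionals of reversed words. In this form the Leibniz rule can be
  -- proved along the recursion for `S`.
  ∂ : (Word → Carrier) → Word → Carrier
  ∂ φ []      = 0#
  ∂ φ (x ∷ w) = residue (φ w) x

  residue-pair : (a : List (Carrier × Word)) → ∀ φ x → residue ⟪ a , φ ⟫ x ≈ ⟪ a , (λ v → residue (φ v) x) ⟫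
  residue-pair a φ (y zero    n p) = refl
  residue-pair a φ (y (suc k) n p) = sym (pair-0 a (λ _ → refl))

  residue-cong : ∀ {r s} x → r ≈ s → residue r x ≈ residue s x
  residue-cong (y zero    n p) eq = eq
  residue-cong (y (suc k) n p) eq = refl

  ∂-cong : ∀ {φ χ} → (∀ w → φ w ≈ χ w) → ∀ w → ∂ φ w ≈ ∂ χ w
  ∂-cong eq []      = refl
  ∂-cong eq (x ∷ w) = residue-cong x (eq w)

  ∂-pair : ∀ (a : Elt) (φ : Word → Word → Carrier) u → ∂ (λ u → ⟪ a , φ u ⟫) u ≈ ⟪ a , (λ v → ∂ (λ u → φ u v) u) ⟫
  ∂-pair a φ []      = sym (pair-0 a (λ _ → refl))
  ∂-pair a φ (x ∷ u) = residue-pair a (φ u) x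

  S-0 : ∀ u v {φ} → (∀ w → φ w ≈ 0#) → S u v φ ≈ 0#
  S-0 u v {φ} eq = trans (S-cong u v (λ w → trans (eq w) (sym (zeroˡ (φ w))))) (trans (S-* u v 0# φ) (zeroˡ _))

  S-residue : ∀ u v φ x → S u v (λ w → residue (φ w) x) ≈ residue (S u v φ) x
  S-residue u v φ (y zero    n p) = refl
  S-residue u v φ (y (suc k) n p) = S-0 u v (λ _ → refl)

  -- The correction term of the product does not contribute, by ⊙-residue.
  S-∂ : ∀ u v φ → S u v (∂ φ) ≈ ∂ (λ u → S u v φ) u + ∂ (λ v → S u v φ) v
  S-∂ [] v φ = trans (S-[]ˡ v (∂ φ)) (trans (∂-cong (λ w → sym (S-[]ˡ w φ)) v) (sym (+-identityˡ _)))
  S-∂ (x ∷ u) [] φ = trans (S-[]ʳ (x ∷ u) (∂ φ)) (trans (residue-cong x (sym (S-[]ʳ u φ))) (sym (+-identityʳ _)))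
  S-∂ (x ∷ u) (z ∷ v) φ = begin
    S (x ∷ u) (z ∷ v) (∂ φ)
      ≈⟨ S-∷ x u z v (∂ φ) ⟩
    S u (z ∷ v) (λ w → residue (φ w) x) + (S (x ∷ u) v (λ w → residue (φ w) z) +
      - μ * S u v (λ w → ⟪ ιs (x ⊙ z) , residue (φ w) ⟫))
      ≈⟨ +-cong (S-residue u (z ∷ v) φ x) (+-cong (S-residue (x ∷ u) v φ z)
           (trans (*-congˡ (S-0 u v (λ w → ⊙-residue x z (φ w)))) (zeroʳ _))) ⟩
    residue (S u (z ∷ v) φ) x + (residue (S (x ∷ u) v φ) z + 0#)
      ≈⟨ +-congˡ (+-identityʳ _) ⟩
    residue (S u (z ∷ v) φ) x + residue (S (x ∷ u) v φ) z ∎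

  πʳ : Word → Elt
  πʳ []                  = []
  πʳ (y zero    n p ∷ w) = ⟨ reverse w ⟩
  πʳ (y (suc k) n p ∷ w) = []

  π : Elt → Elt
  π = concatMap (λ { (r , u) → r · πʳ (reverse u) })

  pair-π-πʳ : ∀ a φ → ⟪ π a , φ ⟫ ≈ ⟪ a , (λ u → ⟪ πʳ (reverse u) , φ ⟫) ⟫
  pair-π-πʳ a φ = pair-concatMap _ _ (λ r u → pair-· r (πʳ (reverse u)) φ) a

  pair-π : ∀ a φ → ⟪ π a , φ ⟫ ≈ ⟪ a , (λ u → ∂ (λ w → φ (reverse w)) (reverse u)) ⟫
  pair-π a φ = trans (pair-π-πʳ a φ) (pair-cong a (λ u → pair-πʳ (reverse u)))
    where
    pair-πʳ : ∀ u → ⟪ πʳ u , φ ⟫ ≈ ∂ (λ w → φ (reverse w)) u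
    pair-πʳ []                  = refl
    pair-πʳ (y zero    n p ∷ w) = pair-single (reverse w) φ
    pair-πʳ (y (suc k) n p ∷ w) = refl

  π-cong : ∀ {a b} → a ≃ b → π a ≃ π b
  π-cong {a} {b} a≃b .at φ = trans (pair-π a φ) (trans (at a≃b _) (sym (pair-π b φ)))

  π-⊕ : ∀ a b → π (a ⊕ b) ≃ π a ⊕ π b
  π-⊕ a b .at φ = begin
    ⟪ π (a ⊕ b) , φ ⟫          ≈⟨ trans (pair-π (a ⊕ b) φ) (pair-++ a b _) ⟩
    _                          ≈⟨ +-cong (pair-π a φ) (pair-π b φ) ⟨
    ⟪ π a , φ ⟫ + ⟪ π b , φ ⟫  ≈⟨ pair-++ (π a) (π b) φ ⟨
    ⟪ π a ⊕ π b , φ ⟫          ∎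

  π-· : ∀ r a → π (r · a) ≃ r · π a
  π-· r a .at φ = begin
    ⟪ π (r · a) , φ ⟫  ≈⟨ trans (pair-π (r · a) φ) (pair-· r a _) ⟩
    _                  ≈⟨ *-congˡ (pair-π a φ) ⟨
    r * ⟪ π a , φ ⟫    ≈⟨ pair-· r (π a) φ ⟨
    ⟪ r · π a , φ ⟫    ∎

  π-∗ : ∀ a b → π (a ∗ b) ≃ (π a ∗ b) ⊕ (a ∗ π b)
  π-∗ a b .at φ = begin
    ⟪ π (a ∗ b) , φ ⟫
      ≈⟨ trans (pair-π (a ∗ b) φ) (pair-∗ a b _) ⟩
    ⟪ a , (λ u → ⟪ b , (λ v → ⟪ stuffleWord u v , (λ w → ∂ φʳ (reverse w)) ⟫) ⟫) ⟫
      ≈⟨ pair-cong a (λ u → pair-cong b (λ v → leibniz u v)) ⟩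
    ⟪ a , (λ u → ⟪ b , (λ v → left u v + right u v) ⟫) ⟫
      ≈⟨ trans (pair-cong a (λ u → pair-+ b _ _)) (pair-+ a _ _) ⟩
    ⟪ a , (λ u → ⟪ b , left u ⟫) ⟫ + ⟪ a , (λ u → ⟪ b , right u ⟫) ⟫
      ≈⟨ +-cong ∗-left ∗-right ⟨
    ⟪ π a ∗ b , φ ⟫ + ⟪ a ∗ π b , φ ⟫
      ≈⟨ pair-++ (π a ∗ b) (a ∗ π b) φ ⟨
    ⟪ (π a ∗ b) ⊕ (a ∗ π b) , φ ⟫ ∎
    where
    φʳ : Word → Carrier
    φʳ w = φ (reverse w)

    left right : Word → Word → Carrier
    left  u v = ∂ (λ u → ⟪ stuffleWord (reverse u) v , φ ⟫) (reverse u)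
    right u v = ∂ (λ v → ⟪ stuffleWord u (reverse v) , φ ⟫) (reverse v)

    leibniz : ∀ u v → ⟪ stuffleWord u v , (λ w → ∂ φʳ (reverse w)) ⟫ ≈ left u v + right u v
    leibniz u v = begin
      ⟪ stuffleWord u v , (λ w → ∂ φʳ (reverse w)) ⟫
        ≈⟨ pair-stuffleWord u v _ ⟩
      S (reverse u) (reverse v) (λ w → ∂ φʳ (reverse (reverse w)))
        ≈⟨ S-cong _ _ (λ w → reflexive (≡.cong (∂ φʳ) (reverse-involutive w))) ⟩
      S (reverse u) (reverse v) (∂ φʳ)
        ≈⟨ S-∂ (reverse u) (reverse v) φʳ ⟩
      ∂ (λ u → S u (reverse v) φʳ) (reverse u) + ∂ (λ v → S (reverse u) v φʳ) (reverse v)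
        ≈⟨ +-cong
             (∂-cong (λ w → trans (pair-stuffleWord (reverse w) v φ) (reflexive (≡.cong (λ w → S w _ _) (reverse-involutive w)))) (reverse u))
             (∂-cong (λ w → trans (pair-stuffleWord u (reverse w) φ) (reflexive (≡.cong (λ w → S _ w _) (reverse-involutive w)))) (reverse v)) ⟨
      left u v + right u v ∎

    ∗-left : ⟪ π a ∗ b , φ ⟫ ≈ ⟪ a , (λ u → ⟪ b , left u ⟫) ⟫
    ∗-left = trans (pair-∗ (π a) b φ) (trans (pair-π a _) (pair-cong a (λ u → ∂-pair b (λ u v → ⟪ stuffleWord (reverse u) v , φ ⟫) (reverse u))))

    ∗-right : ⟪ a ∗ π b , φ ⟫ ≈ ⟪ a , (λ u → ⟪ b , right u ⟫) ⟫
    ∗-right = trans (pair-∗ a (π b) φ) (pair-cong a (λ u → pair-π b _))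

  private
    module 𝔸 = CommutativeSemiring stuffleAlgebra

  -- The kernel of π

  record Ker (a : Elt) : Set (c ⊔ ℓ) where
    constructor mkKer
    field π≃0 : π a ≃ zeroE
  open Ker public

  -- An admissible word does not end in an index 1. The two words of a quasi-admissible element lose
  -- different letters but leave the same prefix, with opposite signs.
  InY⁰⇒Ker : ∀ {a} → InY⁰ a → Ker a
  InY⁰⇒Ker {a} (gs , a≋gs) .π≃0 .at φ = begin
    ⟪ π a , φ ⟫                            ≈⟨ pair-π a φ ⟩
    ⟪ a , χ ⟫                              ≈⟨ at (≋⇒≃ {a} {concatMap (λ { (r , g) → r · ⟦ g ⟧⁰ }) gs} a≋gs) χ ⟩
    ⟪ concatMap (λ { (r , g) → r · ⟦ g ⟧⁰ }) gs , χ ⟫                 ≈⟨ pair-concatMap _ (λ g → ⟪ ⟦ g ⟧⁰ , χ ⟫) (λ r g → pair-· r ⟦ g ⟧⁰ χ) gs ⟩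
    ⟪ gs , (λ g → ⟪ ⟦ g ⟧⁰ , χ ⟫) ⟫        ≈⟨ pair-0 gs vanishes ⟩
    0#                                     ∎
    where
    χ : Word → Carrier
    χ u = ∂ (λ w → φ (reverse w)) (reverse u)

    χ-∷ʳ : ∀ u x → χ (u ∷ʳ x) ≈ residue (φ (reverse (reverse u))) x
    χ-∷ʳ u x = reflexive (≡.cong (∂ (λ w → φ (reverse w))) (reverse-++ u (x ∷ [])))

    vanishes : ∀ g → ⟪ ⟦ g ⟧⁰ , χ ⟫ ≈ 0#
    vanishes (admissible .[] adm-empty) = pair-single [] χ
    vanishes (admissible _ (adm-last u k n q)) = trans (pair-single (u ∷ʳ y (suc k) n q) χ) (χ-∷ʳ u (y (suc k) n q))
    vanishes (quasiAdmissible u n n′ q q′ _) = begin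
      1# * χ (u ∷ʳ y 0 n q) + (- 1# * χ (u ∷ʳ y 0 n′ q′) + 0#)
        ≈⟨ +-cong (*-congˡ (χ-∷ʳ u (y 0 n q))) (+-congʳ (*-congˡ (χ-∷ʳ u (y 0 n′ q′)))) ⟩
      1# * t + (- 1# * t + 0#)
        ≈⟨ +-cong (*-identityˡ t) (trans (+-identityʳ _) (-1*x≈-x t)) ⟩
      t - t
        ≈⟨ -‿inverseʳ t ⟩
      0# ∎
      where t = φ (reverse (reverse u))

  minus : Elt → Elt
  minus a = (- 1#) · a

  pair-minus : ∀ a φ → ⟪ minus a , φ ⟫ ≈ - ⟪ a , φ ⟫
  pair-minus a φ = trans (pair-· (- 1#) a φ) (-1*x≈-x _)

  minus-inverse : ∀ {a b} → a ≃ b → a ⊕ minus b ≃ zeroE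
  minus-inverse {a} {b} a≃b .at φ = trans (pair-++ a (minus b) φ)
    (trans (+-cong (at a≃b φ) (pair-minus b φ)) (-‿inverseʳ _))

  minus-unique : ∀ {a b} → a ⊕ minus b ≃ zeroE → a ≃ b
  minus-unique {a} {b} eq .at φ = begin
    ⟪ a , φ ⟫                             ≈⟨ solve 2 (λ a b → a := (a :- b) :+ b) refl _ ⟪ b , φ ⟫ ⟩
    (⟪ a , φ ⟫ - ⟪ b , φ ⟫) + ⟪ b , φ ⟫   ≈⟨ +-congʳ (trans (+-congˡ (sym (pair-minus b φ))) (sym (pair-++ a (minus b) φ))) ⟩
    ⟪ a ⊕ minus b , φ ⟫ + ⟪ b , φ ⟫       ≈⟨ trans (+-congʳ (at eq φ)) (+-identityˡ _) ⟩
    ⟪ b , φ ⟫                             ∎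

  minus-cancel : ∀ a b → (a ⊕ minus b) ⊕ b ≃ a
  minus-cancel a b .at φ = begin
    ⟪ (a ⊕ minus b) ⊕ b , φ ⟫             ≈⟨ trans (pair-++ (a ⊕ minus b) b φ) (+-congʳ (trans (pair-++ a (minus b) φ) (+-congˡ (pair-minus b φ)))) ⟩
    (⟪ a , φ ⟫ - ⟪ b , φ ⟫) + ⟪ b , φ ⟫   ≈⟨ solve 2 (λ a b → (a :- b) :+ b := a) refl _ _ ⟩
    ⟪ a , φ ⟫                             ∎

  -- Natural number multiples, formal derivative and antiderivative

  nat : ℕ → Carrier
  nat n = ι (natℚ n)

  nat⁻¹ : ℕ → Carrier
  nat⁻¹ n = ι (inv (natℚ n))

  nat-inverseʳ : ∀ n → nat (suc n) * nat⁻¹ (suc n) ≈ 1#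
  nat-inverseʳ n = trans (sym (*-homo _ _))
    (trans (reflexive (≡.cong ι (*-inv (natℚ (suc n)) (natℚ-suc≢0 n)))) 1#-homo)

  nat-suc-· : ∀ n a → nat (suc n) · a ≃ a ⊕ (nat n · a)
  nat-suc-· n a .at φ = begin
    ⟪ nat (suc n) · a , φ ⟫              ≈⟨ pair-· _ a φ ⟩
    nat (suc n) * ⟪ a , φ ⟫              ≈⟨ *-congʳ (trans (+-homo _ _) (+-congʳ 1#-homo)) ⟩
    (1# + nat n) * ⟪ a , φ ⟫             ≈⟨ trans (distribʳ _ _ _) (+-congʳ (*-identityˡ _)) ⟩
    ⟪ a , φ ⟫ + nat n * ⟪ a , φ ⟫        ≈⟨ +-congˡ (pair-· (nat n) a φ) ⟨
    ⟪ a , φ ⟫ + ⟪ nat n · a , φ ⟫        ≈⟨ pair-++ a (nat n · a) φ ⟨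
    ⟪ a ⊕ (nat n · a) , φ ⟫              ∎

  nat-0-· : ∀ a → nat 0 · a ≃ zeroE
  nat-0-· a .at φ = trans (pair-· (nat 0) a φ) (trans (*-congʳ 0#-homo) (zeroˡ _))

  πʳ≃ : ∀ u → πʳ u ≃ π ⟨ reverse u ⟩
  πʳ≃ u .at φ = sym (begin
    ⟪ π ⟨ reverse u ⟩ , φ ⟫   ≈⟨ pair-π-πʳ ⟨ reverse u ⟩ φ ⟩
    ⟪ ⟨ reverse u ⟩ , (λ u → ⟪ πʳ (reverse u) , φ ⟫) ⟫  ≈⟨ pair-single (reverse u) (λ u → ⟪ πʳ (reverse u) , φ ⟫) ⟩
    ⟪ πʳ (reverse (reverse u)) , φ ⟫  ≡⟨ ≡.cong (λ u → ⟪ πʳ u , φ ⟫) (reverse-involutive u) ⟩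
    ⟪ πʳ u , φ ⟫              ∎)

  ker-⊕ : ∀ {a b} → Ker a → Ker b → Ker (a ⊕ b)
  ker-⊕ {a} {b} ka kb .π≃0 = 𝔸.trans (π-⊕ a b) (⊕-cong (π≃0 ka) (π≃0 kb))

  ker-· : ∀ r {a} → Ker a → Ker (r · a)
  ker-· r {a} ka .π≃0 = 𝔸.trans (π-· r a) (·-cong r (π≃0 ka))

  coeffT-+ₚ : ∀ i P Q → coeffT i (P +ₚ Q) ≃ coeffT i P ⊕ coeffT i Q
  coeffT-+ₚ i       []      Q       = 𝔸.refl
  coeffT-+ₚ i       (a ∷ P) []      = 𝔸.sym (𝔸.+-identityʳ _)
  coeffT-+ₚ zero    (a ∷ P) (b ∷ Q) = 𝔸.refl
  coeffT-+ₚ (suc i) (a ∷ P) (b ∷ Q) = coeffT-+ₚ i P Q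

  coeffT-minus : ∀ i P → coeffT i (map minus P) ≃ minus (coeffT i P)
  coeffT-minus i       []      = 𝔸.refl
  coeffT-minus zero    (a ∷ P) = 𝔸.refl
  coeffT-minus (suc i) (a ∷ P) = coeffT-minus i P

  all-ker-+ₚ : ∀ {P Q} → All Ker P → All Ker Q → All Ker (P +ₚ Q)
  all-ker-+ₚ []        kQ        = kQ
  all-ker-+ₚ (ka ∷ kP) []        = ka ∷ kP
  all-ker-+ₚ (ka ∷ kP) (kb ∷ kQ) = ker-⊕ ka kb ∷ all-ker-+ₚ kP kQ

  all-ker-· : ∀ r {P} → All Ker P → All Ker (map (r ·_) P)
  all-ker-· r []        = []
  all-ker-· r (ka ∷ kP) = ker-· r ka ∷ all-ker-· r kP

  -- This sends P to nP + TP', that is, to the derivative of T^n P divided by T^(n-1). The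
  -- derivative of `w ∷ P` is therefore `dFrom 1 P`.
  dFrom : ℕ → Poly → Poly
  dFrom n []      = []
  dFrom n (w ∷ P) = (nat n · w) ∷ dFrom (suc n) P

  -- The antiderivative of T^n P divided by T^(n+1): the antiderivative of P without constant term
  -- is `zeroE ∷ iFrom 0 P`.
  iFrom : ℕ → Poly → Poly
  iFrom n []      = []
  iFrom n (w ∷ P) = (nat⁻¹ (suc n) · w) ∷ iFrom (suc n) P

  length-dFrom : ∀ n P → length (dFrom n P) ≡ length P
  length-dFrom n []      = ≡.refl
  length-dFrom n (w ∷ P) = ≡.cong suc (length-dFrom (suc n) P)

  all-ker-dFrom : ∀ n {P} → All Ker P → All Ker (dFrom n P)
  all-ker-dFrom n []        = []
  all-ker-dFrom n (kw ∷ kP) = ker-· (nat n) kw ∷ all-ker-dFrom (suc n) kP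

  all-ker-iFrom : ∀ n {P} → All Ker P → All Ker (iFrom n P)
  all-ker-iFrom n []        = []
  all-ker-iFrom n (kw ∷ kP) = ker-· (nat⁻¹ (suc n)) kw ∷ all-ker-iFrom (suc n) kP

  dFrom-iFrom : ∀ n P i → coeffT i (dFrom (suc n) (iFrom n P)) ≃ coeffT i P
  dFrom-iFrom n []      i       = 𝔸.refl
  dFrom-iFrom n (w ∷ P) zero    = ·-inverse (nat (suc n)) (nat⁻¹ (suc n)) w (nat-inverseʳ n)
  dFrom-iFrom n (w ∷ P) (suc i) = dFrom-iFrom (suc n) P i

  dFrom-injective : ∀ n P → (∀ i → coeffT i (dFrom (suc n) P) ≃ zeroE) → ∀ i → coeffT i P ≃ zeroE
  dFrom-injective n []      eq i       = 𝔸.refl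
  dFrom-injective n (w ∷ P) eq zero    = 𝔸.trans
    (𝔸.sym (·-inverse (nat⁻¹ (suc n)) (nat (suc n)) w (trans (*-comm _ _) (nat-inverseʳ n))))
    (·-cong (nat⁻¹ (suc n)) (eq 0))
  dFrom-injective n (w ∷ P) eq (suc i) = dFrom-injective (suc n) P (λ i → eq (suc i)) i

  module _ (m : ℚ) .(p : Positive m) where

    -- In every word of `a` that ends in some y_{1,n}, this letter is replaced by y_{1,m} at the
    -- cost of a quasi-admissible element. The replaced words add up to `π a` with y_{1,m} appended,
    -- which vanishes. When n is already m the word contributes no generator.
    Ker⇒InY⁰ : ∀ {a} → Ker a → InY⁰ a
    Ker⇒InY⁰ {a} ka = gens , ≃⇒≋ {a} {concatMap (λ { (r , g) → r · ⟦ g ⟧⁰ }) gens} (mk≃ (λ φ → begin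
      ⟪ a , φ ⟫
        ≈⟨ pair-cong a (λ u → decompose φ u) ⟩
      ⟪ a , (λ u → ⟪ gensʳ (reverse u) , (λ g → ⟪ ⟦ g ⟧⁰ , φ ⟫) ⟫ + ∂ (λ w → φ (reverse w ∷ʳ y 0 m p)) (reverse u)) ⟫
        ≈⟨ pair-+ a _ _ ⟩
      ⟪ a , (λ u → ⟪ gensʳ (reverse u) , (λ g → ⟪ ⟦ g ⟧⁰ , φ ⟫) ⟫) ⟫ + ⟪ a , (λ u → ∂ (λ w → φ (reverse w ∷ʳ y 0 m p)) (reverse u)) ⟫
        ≈⟨ +-cong (pair-gens φ) (pair-π a (λ w → φ (w ∷ʳ y 0 m p))) ⟨
      ⟪ gens , (λ g → ⟪ ⟦ g ⟧⁰ , φ ⟫) ⟫ + ⟪ π a , (λ w → φ (w ∷ʳ y 0 m p)) ⟫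
        ≈⟨ trans (+-congˡ (at (π≃0 ka) _)) (+-identityʳ _) ⟩
      ⟪ gens , (λ g → ⟪ ⟦ g ⟧⁰ , φ ⟫) ⟫
        ≈⟨ pair-concatMap _ (λ g → ⟪ ⟦ g ⟧⁰ , φ ⟫) (λ r g → pair-· r ⟦ g ⟧⁰ φ) gens ⟨
      ⟪ concatMap (λ { (r , g) → r · ⟦ g ⟧⁰ }) gens , φ ⟫ ∎))
      where
      gensʳ : Word → List (Carrier × Gen⁰)
      gensʳ []                  = (1# , admissible [] adm-empty) ∷ []
      gensʳ (y (suc k) n q ∷ u) = (1# , admissible (reverse u ∷ʳ y (suc k) n q) (adm-last (reverse u) k n q)) ∷ []
      gensʳ (y zero    n q ∷ u) with n ℚ.≟ m
      ... | yes _  = []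
      ... | no n≢m = (1# , quasiAdmissible (reverse u) n m q p n≢m) ∷ []

      gens : List (Carrier × Gen⁰)
      gens = concatMap (λ { (r , u) → map (λ { (s , g) → (r * s , g) }) (gensʳ (reverse u)) }) a

      pair-gens : ∀ φ → ⟪ gens , (λ g → ⟪ ⟦ g ⟧⁰ , φ ⟫) ⟫ ≈ ⟪ a , (λ u → ⟪ gensʳ (reverse u) , (λ g → ⟪ ⟦ g ⟧⁰ , φ ⟫) ⟫) ⟫
      pair-gens φ = pair-concatMap _ _ (λ r u → trans
        (pair-map _ (λ g → r * ⟪ ⟦ g ⟧⁰ , φ ⟫)
          (λ s g → solve 3 (λ r s t → r :* s :* t := s :* (r :* t)) refl r s ⟪ ⟦ g ⟧⁰ , φ ⟫) (gensʳ (reverse u)))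
        (pair-* (gensʳ (reverse u)) r _)) a

      decomposeʳ : ∀ φ u → φ (reverse u) ≈ ⟪ gensʳ u , (λ g → ⟪ ⟦ g ⟧⁰ , φ ⟫) ⟫ + ∂ (λ w → φ (reverse w ∷ʳ y 0 m p)) u
      decomposeʳ φ [] = sym (trans (+-identityʳ _) (trans (pair-single (admissible [] adm-empty) (λ g → ⟪ ⟦ g ⟧⁰ , φ ⟫)) (pair-single [] φ)))
      decomposeʳ φ (y (suc k) n q ∷ u) = trans (reflexive (≡.cong φ (unfold-reverse _ u)))
        (sym (trans (+-identityʳ _) (trans (pair-single (admissible _ (adm-last (reverse u) k n q)) (λ g → ⟪ ⟦ g ⟧⁰ , φ ⟫)) (pair-single (reverse u ∷ʳ y (suc k) n q) φ))))
      decomposeʳ φ (y zero n q ∷ u) with n ℚ.≟ m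
      ... | yes ≡.refl = trans (reflexive (≡.cong φ (unfold-reverse _ u))) (sym (+-identityˡ _))
      ... | no n≢m = trans (reflexive (≡.cong φ (unfold-reverse _ u))) (sym (begin
        1# * (1# * s + (- 1# * t + 0#)) + 0# + t ≈⟨ +-congʳ (trans (+-identityʳ _) (trans (*-identityˡ _) (+-cong (*-identityˡ s) (trans (+-identityʳ _) (-1*x≈-x t))))) ⟩
        s - t + t                                ≈⟨ solve 2 (λ s t → s :- t :+ t := s) refl s t ⟩
        s                                        ∎))
        where
        s = φ (reverse u ∷ʳ y 0 n q)
        t = φ (reverse u ∷ʳ y 0 m p)

      decompose : ∀ φ u → φ u ≈ ⟪ gensʳ (reverse u) , (λ g → ⟪ ⟦ g ⟧⁰ , φ ⟫) ⟫ + ∂ (λ w → φ (reverse w ∷ʳ y 0 m p)) (reverse u)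
      decompose φ u = trans (reflexive (≡.cong φ (≡.sym (reverse-involutive u)))) (decomposeʳ φ (reverse u))

-- Proved over an arbitrary semiring, so that the solver works with opaque operations and not with
-- lists of words.
module HornerIdentities {a b : Level} (𝔹 : CommutativeSemiring a b) where

  open CommutativeSemiring 𝔹
  open SemiringSolver 𝔹 using (solve; _:=_; _:+_; _:*_)

  horner-power : ∀ w t s e → w * t + s * t * e ≈ t * (w + s * e)
  horner-power = solve 4 (λ w t s e → w :* t :+ s :* t :* e := t :* (w :+ s :* e)) refl

  horner-+ : ∀ a b s e f → (a + b) + s * (e + f) ≈ (a + s * e) + (b + s * f)
  horner-+ = solve 5 (λ a b s e f → (a :+ b) :+ s :* (e :+ f) := (a :+ s :* e) :+ (b :+ s :* f)) refl

  horner-scale : ∀ w a s e → w * a + s * (w * e) ≈ w * (a + s * e)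
  horner-scale = solve 4 (λ w a s e → w :* a :+ s :* (w :* e) := w :* (a :+ s :* e)) refl

  horner-* : ∀ a s e f → a * f + s * (e * f) ≈ (a + s * e) * f
  horner-* = solve 4 (λ a s e f → a :* f :+ s :* (e :* f) := (a :+ s :* e) :* f) refl

  horner-derivative : ∀ a s e f g → a + s * ((e + f) + s * g) ≈ (a + s * f) + s * (e + s * g)
  horner-derivative = solve 5 (λ a s e f g → a :+ s :* ((e :+ f) :+ s :* g) := (a :+ s :* f) :+ s :* (e :+ s :* g)) refl

-- Polynomials over the kernel evaluated at a slice

module SliceIsomorphism {c ℓ : Level} (R : CommutativeRing c ℓ) (ι : ℚ → CommutativeRing.Carrier R)
  (ι-hom : IsRingHomomorphism +-*-rawRing (CommutativeRing.rawRing R) ι)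
  (μ : CommutativeRing.Carrier R) where

  open CommutativeRing R using (1#; -_; *-cong; *-identityʳ; +-congʳ; reflexive)
  open Setup R ι μ
  open StuffleAlgebra R ι ι-hom μ

  private
    module 𝔸 = CommutativeSemiring stuffleAlgebra
  open SetoidReasoning 𝔸.setoid
  open HornerIdentities stuffleAlgebra

  ∗-congˡ : ∀ a {b b′} → b ≃ b′ → a ∗ b ≃ a ∗ b′
  ∗-congˡ a {b} {b′} = ∗-cong {a} {a} {b} {b′} 𝔸.refl

  module SliceTheorem (s : Elt) (π-s : π s ≃ oneE) where

    -- The Horner form of evaluation at T = s avoids powers, so that arguments about it are
    -- inductions on the coefficient list; `ψFrom≃` translates back.
    ev : Poly → Elt
    ev []      = zeroE
    ev (w ∷ P) = w ⊕ (s ∗ ev P)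

    ev-cong : ∀ P Q → (∀ i → coeffT i P ≃ coeffT i Q) → ev P ≃ ev Q
    ev-cong []      []      eq = 𝔸.refl
    ev-cong []      (b ∷ Q) eq = 𝔸.sym (𝔸.trans (⊕-cong (𝔸.sym (eq 0)) (∗-congˡ s (𝔸.sym (ev-cong [] Q (λ i → eq (suc i)))))) (𝔸.zeroʳ s))
    ev-cong (a ∷ P) []      eq = 𝔸.trans (⊕-cong (eq 0) (∗-congˡ s (ev-cong P [] (λ i → eq (suc i))))) (𝔸.zeroʳ s)
    ev-cong (a ∷ P) (b ∷ Q) eq = ⊕-cong (eq 0) (∗-congˡ s (ev-cong P Q (λ i → eq (suc i))))

    ev-+ₚ : ∀ P Q → ev (P +ₚ Q) ≃ ev P ⊕ ev Q
    ev-+ₚ []      Q       = 𝔸.refl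
    ev-+ₚ (a ∷ P) []      = 𝔸.sym (𝔸.+-identityʳ (ev (a ∷ P)))
    ev-+ₚ (a ∷ P) (b ∷ Q) = 𝔸.trans (𝔸.+-congˡ {a ⊕ b} (∗-congˡ s (ev-+ₚ P Q)))
      (horner-+ a b s (ev P) (ev Q))

    ev-map-∗ : ∀ w P → ev (map (w ∗_) P) ≃ w ∗ ev P
    ev-map-∗ w []      = 𝔸.sym (𝔸.zeroʳ w)
    ev-map-∗ w (a ∷ P) = 𝔸.trans (𝔸.+-congˡ {w ∗ a} (∗-congˡ s (ev-map-∗ w P)))
      (horner-scale w a s (ev P))

    ev-map-· : ∀ r P → ev (map (r ·_) P) ≃ r · ev P
    ev-map-· r []      = 𝔸.refl
    ev-map-· r (a ∷ P) = 𝔸.trans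
      (𝔸.+-congˡ {r · a} (𝔸.trans (∗-congˡ s (ev-map-· r P)) (∗-· r s (ev P))))
      (𝔸.sym (·-⊕ r a (s ∗ ev P)))

    ev-*ₚ : ∀ P Q → ev (P *ₚ Q) ≃ ev P ∗ ev Q
    ev-*ₚ []      Q = 𝔸.refl
    ev-*ₚ (a ∷ P) Q = 𝔸.trans (ev-+ₚ (map (a ∗_) Q) (zeroE ∷ (P *ₚ Q)))
      (𝔸.trans (⊕-cong (ev-map-∗ a Q) (∗-congˡ s (ev-*ₚ P Q)))
        (horner-* a s (ev P) (ev Q)))

    π-ev-∷ : ∀ w P → Ker w → π (ev (w ∷ P)) ≃ ev P ⊕ (s ∗ π (ev P))
    π-ev-∷ w P kw = begin
      π (w ⊕ (s ∗ ev P))                       ≈⟨ π-⊕ w (s ∗ ev P) ⟩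
      π w ⊕ π (s ∗ ev P)                       ≈⟨ ⊕-cong (π≃0 kw) (π-∗ s (ev P)) ⟩
      (π s ∗ ev P) ⊕ (s ∗ π (ev P))            ≈⟨ 𝔸.+-congʳ {s ∗ π (ev P)} (∗-cong π-s (𝔸.refl {ev P})) ⟩
      (oneE ∗ ev P) ⊕ (s ∗ π (ev P))           ≈⟨ 𝔸.+-congʳ {s ∗ π (ev P)} (∗-identityˡ (ev P)) ⟩
      ev P ⊕ (s ∗ π (ev P))                    ∎

    -- On kernel coefficients π acts as d/dT, so this is nP + TP' evaluated at s. The offset `n` is
    -- general because passing to the tail raises it by one.
    ev-dFrom : ∀ n {P} → All Ker P → ev (dFrom n P) ≃ (nat n · ev P) ⊕ (s ∗ π (ev P))
    ev-dFrom n []                  = 𝔸.sym (𝔸.zeroʳ s)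
    ev-dFrom n {w ∷ P} (kw ∷ kP) = begin
      (nat n · w) ⊕ (s ∗ ev (dFrom (suc n) P))
        ≈⟨ 𝔸.+-congˡ {nat n · w} (∗-congˡ s (𝔸.trans (ev-dFrom (suc n) kP) (𝔸.+-congʳ {s ∗ π (ev P)} (nat-suc-· n (ev P))))) ⟩
      (nat n · w) ⊕ (s ∗ ((ev P ⊕ (nat n · ev P)) ⊕ (s ∗ π (ev P))))
        ≈⟨ horner-derivative (nat n · w) s (ev P) (nat n · ev P) (π (ev P)) ⟩
      ((nat n · w) ⊕ (s ∗ (nat n · ev P))) ⊕ (s ∗ (ev P ⊕ (s ∗ π (ev P))))
        ≈⟨ ⊕-cong (𝔸.trans (𝔸.+-congˡ {nat n · w} (∗-· (nat n) s (ev P))) (𝔸.sym (·-⊕ (nat n) w (s ∗ ev P))))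
                  (∗-congˡ s (𝔸.sym (π-ev-∷ w P kw))) ⟩
      (nat n · ev (w ∷ P)) ⊕ (s ∗ π (ev (w ∷ P))) ∎

    π-ev : ∀ w {P} → Ker w → All Ker P → π (ev (w ∷ P)) ≃ ev (dFrom 1 P)
    π-ev w {P} kw kP = begin
      π (ev (w ∷ P))                        ≈⟨ π-ev-∷ w P kw ⟩
      ev P ⊕ (s ∗ π (ev P))                 ≈⟨ 𝔸.+-congʳ {s ∗ π (ev P)} (𝔸.trans (nat-suc-· 0 (ev P)) (𝔸.trans (𝔸.+-congˡ {ev P} (nat-0-· (ev P))) (𝔸.+-identityʳ (ev P)))) ⟨
      (nat 1 · ev P) ⊕ (s ∗ π (ev P))       ≈⟨ ev-dFrom 1 kP ⟨
      ev (dFrom 1 P)                        ∎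

    -- Applying π to the relation gives one for the derivative, which has one coefficient less but
    -- is not a sublist; hence the induction on the length. Once the higher coefficients vanish, the
    -- value is the constant term itself.
    ev-injective₀ : ∀ n P → length P ≡ n → All Ker P → ev P ≃ zeroE → ∀ i → coeffT i P ≃ zeroE
    ev-injective₀ n       []      len []        eq i = 𝔸.refl
    ev-injective₀ (suc n) (w ∷ P) len (kw ∷ kP) eq = λ where
        zero    → 𝔸.trans (𝔸.sym (𝔸.trans (𝔸.+-congˡ {w} (𝔸.trans (∗-congˡ s (ev-cong P [] P≃0)) (𝔸.zeroʳ s))) (𝔸.+-identityʳ w))) eq
        (suc i) → P≃0 i
      where
      P≃0 : ∀ i → coeffT i P ≃ zeroE
      P≃0 = dFrom-injective 0 P (ev-injective₀ n (dFrom 1 P)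
        (≡.trans (length-dFrom 1 P) (ℕₚ.suc-injective len)) (all-ker-dFrom 1 kP)
        (𝔸.trans (𝔸.sym (π-ev w kw kP)) (π-cong eq)))

    ev-injective : ∀ P Q → All Ker P → All Ker Q → ev P ≃ ev Q → ∀ i → coeffT i P ≃ coeffT i Q
    ev-injective P Q kP kQ eq i = minus-unique (begin
      coeffT i P ⊕ minus (coeffT i Q)        ≈⟨ 𝔸.+-congˡ {coeffT i P} (coeffT-minus i Q) ⟨
      coeffT i P ⊕ coeffT i (map minus Q)    ≈⟨ coeffT-+ₚ i P (map minus Q) ⟨
      coeffT i (P +ₚ map minus Q)            ≈⟨ ev-injective₀ _ (P +ₚ map minus Q) ≡.refl (all-ker-+ₚ kP (all-ker-· (- 1#) kQ))
                                                  (𝔸.trans (ev-+ₚ P (map minus Q))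
                                                    (𝔸.trans (𝔸.+-congˡ {ev P} (ev-map-· (- 1#) Q)) (minus-inverse eq))) i ⟩
      zeroE                                  ∎)

    Image : Elt → Set (c ⊔ ℓ)
    Image a = Σ Poly λ P → All Ker P × ev P ≃ a

    -- Integrate a polynomial representing π a, and correct the constant term.
    Image-lift : ∀ a → Image (π a) → Image a
    Image-lift a (Q , kQ , evQ≃πa) = (a ⊕ minus b) ∷ I , k₀ ∷ kI , minus-cancel a b
      where
      I : Poly
      I = iFrom 0 Q

      kI : All Ker I
      kI = all-ker-iFrom 0 kQ

      b : Elt
      b = s ∗ ev I

      πb≃πa : π b ≃ π a
      πb≃πa = 𝔸.trans (π-ev zeroE (mkKer 𝔸.refl) kI) (𝔸.trans (ev-cong (dFrom 1 I) Q (dFrom-iFrom 0 Q)) evQ≃πa)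

      k₀ : Ker (a ⊕ minus b)
      k₀ .π≃0 = 𝔸.trans (π-⊕ a (minus b)) (𝔸.trans (𝔸.+-congˡ {π a} (π-· (- 1#) b)) (minus-inverse (𝔸.sym πb≃πa)))

    Image-cong : ∀ {a b} → a ≃ b → Image a → Image b
    Image-cong a≃b (P , kP , eq) = P , kP , 𝔸.trans eq a≃b

    -- Local nilpotence of π appears here as structural recursion: π turns a word into 0 or into the
    -- same word without its last letter.
    Image-word : ∀ u → Image ⟨ reverse u ⟩
    Image-word u = Image-lift ⟨ reverse u ⟩ (Image-cong (πʳ≃ u) (Image-πʳ u))
      where
      Image-πʳ : ∀ u → Image (πʳ u)
      Image-πʳ []                  = [] , [] , 𝔸.refl
      Image-πʳ (y zero    n q ∷ u) = Image-word u
      Image-πʳ (y (suc k) n q ∷ u) = [] , [] , 𝔸.refl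

    ev-surjective : ∀ a → Image a
    ev-surjective []            = [] , [] , 𝔸.refl
    ev-surjective ((r , w) ∷ a) with Image-word (reverse w) | ev-surjective a
    ... | P , kP , evP | Q , kQ , evQ =
      map (r ·_) P +ₚ Q , all-ker-+ₚ (all-ker-· r kP) kQ ,
      𝔸.trans (ev-+ₚ (map (r ·_) P) Q) (𝔸.trans (⊕-cong (𝔸.trans (ev-map-· r P) (·-cong r evP)) evQ)
        (mk≃ (λ φ → +-congʳ (*-cong (*-identityʳ r) (reflexive (≡.cong φ (reverse-involutive w)))))))

  module _ (m : ℚ) .(p : Positive m) where

    private
      s : Elt
      s = y₁ m p

    π-y₁ : π s ≃ oneE
    π-y₁ = 𝔸.sym (πʳ≃ (y 0 m p ∷ []))

    open SliceTheorem s π-y₁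

    ψFrom≃ : ∀ i P → ψFrom m p i P ≃ (s ^∗ i) ∗ ev P
    ψFrom≃ i []      = 𝔸.sym (𝔸.zeroʳ (s ^∗ i))
    ψFrom≃ i (w ∷ P) = 𝔸.trans (𝔸.+-congˡ {w ∗ (s ^∗ i)} (ψFrom≃ (suc i) P))
      (horner-power w (s ^∗ i) s (ev P))

    ψ≃ev : ∀ P → ψ m p P ≃ ev P
    ψ≃ev P = 𝔸.trans (ψFrom≃ 0 P) (∗-identityˡ (ev P))

    ψ-isY⁰AlgebraIso : IsY⁰AlgebraIso (ψ m p)
    ψ-isY⁰AlgebraIso = record
      { well-defined   = λ P Q _ _ P≋Q → ≃⇒≋ (via (ψ≃ev P) (ψ≃ev Q) (ev-cong P Q (λ i → ≋⇒≃ (P≋Q i))))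
      ; additive       = λ P Q _ _ → ≃⇒≋ (via (ψ≃ev (P +ₚ Q)) (⊕-cong (ψ≃ev P) (ψ≃ev Q)) (ev-+ₚ P Q))
      ; multiplicative = λ P Q _ _ → ≃⇒≋ (via (ψ≃ev (P *ₚ Q)) (∗-cong (ψ≃ev P) (ψ≃ev Q)) (ev-*ₚ P Q))
      ; unital         = ≃⇒≋ (𝔸.trans (ψ≃ev oneₚ) (𝔸.trans (𝔸.+-congˡ {oneE} (𝔸.zeroʳ (y₁ m p))) (𝔸.+-identityʳ oneE)))
      ; Y⁰-linear      = λ w P _ _ → ≃⇒≋ (via (ψ≃ev (map (w ∗_) P)) (∗-congˡ w (ψ≃ev P)) (ev-map-∗ w P))
      ; injective      = λ P Q P∈Y⁰ Q∈Y⁰ eq i → ≃⇒≋ (ev-injective P Q (All.map InY⁰⇒Ker P∈Y⁰) (All.map InY⁰⇒Ker Q∈Y⁰)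
                           (𝔸.trans (𝔸.sym (ψ≃ev P)) (𝔸.trans (≋⇒≃ eq) (ψ≃ev Q))) i)
      ; surjective     = λ a → let (P , kP , eq) = ev-surjective a in
                           P , All.map (Ker⇒InY⁰ m p) kP , ≃⇒≋ (𝔸.trans (ψ≃ev P) eq)
      }
      where
      via : ∀ {a a′ b b′} → a ≃ a′ → b ≃ b′ → a′ ≃ b′ → a ≃ b
      via a≃a′ b≃b′ a′≃b′ = 𝔸.trans a≃a′ (𝔸.trans a′≃b′ (𝔸.sym b≃b′))

theorem4p3 : {c ℓ : Level} (R : CommutativeRing c ℓ) (ι : ℚ → CommutativeRing.Carrier R) →
    IsRingHomomorphism +-*-rawRing (CommutativeRing.rawRing R) ι →
    (μ : CommutativeRing.Carrier R) (m : ℚ) (m>0 : Positive m) →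
    Setup.IsY⁰AlgebraIso R ι μ (Setup.ψ R ι μ m m>0)
theorem4p3 R ι ι-hom μ m m>0 = SliceIsomorphism.ψ-isY⁰AlgebraIso R ι ι-hom μ m m>0
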